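{- For every $k\in\mathbb{Z}_{\ge0}$ there exist integers $m_\sigma\in\mathbb{Z}_{\ge0}$, indexed by $\sigma\in S_n$ with $1\le n\le k+1$ and $\ell(\sigma)\le k$, such that in $\mathrm{End}_{\mathcal H}(Q_+)$ \[ x^k=\sum_{n=1}^{k+1}\ \sum_{\substack{\sigma\in S_n\\ \ell(\sigma)\le k}} m_\sigma\,\mathrm{Tr}'\big(\varphi_n(\sigma)\big), \] and moreover $m_\sigma=0$ unless $\ell(\sigma)\equiv k\pmod 2$.
   Context: Khovanov's Heisenberg category $\mathcal{H}$ is the $\mathbb{C}$-linear strict monoidal category whose objects are finite direct sums of words $Q_\varepsilon=Q_{\varepsilon_1}\otimes\cdots\otimes Q_{\varepsilon_m}$, $\varepsilon_i\in\{+,-\}$ (empty word = unit $\mathbf1$). Morphisms $Q_\varepsilon\to Q_{\varepsilon'}$ are $\mathbb{C}$-linear combinations of isotopy classes (rel boundary) of planar oriented string diagrams with transversal crossings, bottom endpoints reading $\varepsilon$ and top endpoints reading $\varepsilon'$ ($+$ = strand oriented upward at that endpoint, $-$ = downward); composition is vertical stacking (source at bottom), $\otimes$ is horizontal juxtaposition (left factor on the left). Local relations: (1) two upward strands crossing twice equal two parallel upward strands; (2) braid relation for three upward strands; (3) on $Q_+\otimes Q_-$ the double crossing is the identity; (4) on $Q_-\otimes Q_+$ the double crossing equals the identity minus (cap $Q_-\otimes Q_+\to\mathbf 1$ followed by cup $\mathbf1\to Q_-\otimes Q_+$); (5) a counterclockwise circle equals $1$; (6) an upward strand with a curl on its left-hand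 side is $0$. The dot $x\in\mathrm{End}(Q_+)$ is the upward strand with a curl on its right-hand side, $x^k$ its $k$-fold composite. By relations (1),(2) there is an algebra homomorphism $\varphi_n\colon\mathbb{C}[S_n]\to\mathrm{End}(Q_+^{\otimes n})$ sending $s_i=(i\ i{+}1)$ to the crossing of the $i$-th and $(i{+}1)$-th upward strands. For $f\in\mathrm{End}(Q_+^{\otimes n})$, the partial closure $\mathrm{Tr}'(f)\in\mathrm{End}(Q_+)$ is obtained by leaving the leftmost (first) strand open and joining, for each $j=2,\dots,n$, the $j$-th top endpoint to the $j$-th bottom endpoint by an arc passing to the right of the diagram, arcs nested with the $n$-th innermost (so they are oriented clockwise); for $n=1$, $\mathrm{Tr}'(f)=f$. $\ell(\sigma)$ denotes the Coxeter length of $\sigma\in S_n$ (minimal number of simple transpositions $s_i$ needed to write $\sigma$). -}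

module Defs where

open import Level using (_⊔_)
open import Algebra.Bundles using (CommutativeRing)
open import Data.Nat using (ℕ; zero; suc; _≤_)
open import Data.Fin as Fin using (Fin; zero; suc; inject₁)
open import Data.List as List using (List; []; _∷_; _++_; length; replicate; filter; concatMap; foldr; upTo)
open import Data.List.Properties using (++-assoc; ++-identityʳ)
open import Data.Vec as Vec using (Vec; toList)
open import Data.Product using (Σ; _×_; _,_)
open import Relation.Nullary using (does)
open import Data.Bool using (true; false)
open import Relation.Binary.PropositionalEquality using (_≡_; refl; subst)
import Data.List.Relation.Unary.Unique.DecPropositional as UniqueDec

-- Objects of Khovanov's Heisenberg category: words in {+,-}.
-- ↑ is Q₊ (upward strand), ↓ is Q₋ (downward strand).

data Sign : Set where
  ↑ ↓ : Sign

Obj : Set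
Obj = List Sign

ups : ℕ → Obj
ups n = replicate n ↑

downs : ℕ → Obj
downs n = replicate n ↓

downs-snoc : (n : ℕ) → downs n ++ (↓ ∷ []) ≡ downs (suc n)
downs-snoc zero = refl
downs-snoc (suc n) rewrite downs-snoc n = refl

ups-snoc : (n : ℕ) → ups n ++ (↑ ∷ []) ≡ ups (suc n)
ups-snoc zero = refl
ups-snoc (suc n) rewrite ups-snoc n = refl

-- Symmetric groups.  An element σ ∈ S_n is represented by the vector
-- (σ(0), …, σ(n-1)); it is a permutation iff its entries are distinct.

Perm : ℕ → Set
Perm n = Vec (Fin n) n

open module UFin {n : ℕ} = UniqueDec (Fin._≟_ {n}) using (Unique; unique?)

IsPerm : ∀ {n} → Vec (Fin n) n → Set
IsPerm v = Unique (toList v)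

allVecs : ∀ {n} → (m : ℕ) → List (Vec (Fin n) m)
allVecs zero = Vec.[] ∷ []
allVecs {n} (suc m) = concatMap (λ v → List.map (Vec._∷ v) (List.allFin n)) (allVecs m)

allPerms : (n : ℕ) → List (Perm n)
allPerms n = filter (λ v → unique? (toList v)) (allVecs n)

-- Words in the simple transpositions of S_{n'+1}: the letter i : Fin n'
-- stands for s_{i+1} = (i+1  i+2) (1-based), i.e. swaps inject₁ i and suc i.
Word : ℕ → Set
Word n' = List (Fin n')

swapF : ∀ {n'} → Fin n' → Fin (suc n') → Fin (suc n')
swapF i j with does (j Fin.≟ inject₁ i) | does (j Fin.≟ suc i)
... | true  | _ = suc i
... | false | true = inject₁ i
... | false | false = j

prodW : ∀ {n'} → Word n' → Perm (suc n')
prodW {n'} [] = Vec.allFin (suc n')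
prodW (i ∷ w) = Vec.map (swapF i) (prodW w)

IsLength : ∀ {n'} → Perm (suc n') → ℕ → Set
IsLength {n'} σ L =
  Σ (Word n') (λ w → prodW w ≡ σ × length w ≡ L)
  × ((w : Word n') → prodW w ≡ σ → L ≤ length w)

module Heis {c ℓ} (R : CommutativeRing c ℓ) where
  open CommutativeRing R using ()
    renaming (Carrier to K; _+_ to _+ᴿ_; _*_ to _*ᴿ_; 0# to 0ᴿ; 1# to 1ᴿ; -_ to -ᴿ_; _≈_ to _≈ᴿ_)

  infixr 9 _·_
  infixr 7 _⊗_
  infixr 6 _∘_
  infixl 5 _+ₘ_

  data Mor : Obj → Obj → Set c where
    idm   : (a : Obj) → Mor a a
    _∘_   : ∀ {a b d} → Mor b d → Mor a b → Mor a d
    _⊗_   : ∀ {a b a' b'} → Mor a b → Mor a' b' → Mor (a ++ a') (b ++ b')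
    -- crossing of two upward strands
    X     : Mor (↑ ∷ ↑ ∷ []) (↑ ∷ ↑ ∷ [])
    cup↑↓ : Mor [] (↑ ∷ ↓ ∷ [])      -- clockwise cup
    cup↓↑ : Mor [] (↓ ∷ ↑ ∷ [])      -- counterclockwise cup
    cap↑↓ : Mor (↑ ∷ ↓ ∷ []) []      -- clockwise cap
    cap↓↑ : Mor (↓ ∷ ↑ ∷ []) []      -- counterclockwise cap
    zer   : ∀ {a b} → Mor a b
    _+ₘ_  : ∀ {a b} → Mor a b → Mor a b → Mor a b
    _·_   : ∀ {a b} → K → Mor a b → Mor a b

  castM : ∀ {a a' b b'} → a ≡ a' → b ≡ b' → Mor a b → Mor a' b'
  castM refl refl f = f

  id↑ : Mor (↑ ∷ []) (↑ ∷ [])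
  id↑ = idm (↑ ∷ [])

  id↓ : Mor (↓ ∷ []) (↓ ∷ [])
  id↓ = idm (↓ ∷ [])

  cupN  : Mor [] (↑ ∷ ↑ ∷ ↓ ∷ ↓ ∷ [])
  cupN  = (id↑ ⊗ (cup↑↓ ⊗ id↓)) ∘ cup↑↓
  capN  : Mor (↓ ∷ ↓ ∷ ↑ ∷ ↑ ∷ []) []
  capN  = cap↓↑ ∘ (id↓ ⊗ (cap↓↑ ⊗ id↑))
  cupN' : Mor [] (↓ ∷ ↓ ∷ ↑ ∷ ↑ ∷ [])
  cupN' = (id↓ ⊗ (cup↓↑ ⊗ id↑)) ∘ cup↓↑
  capN' : Mor (↑ ∷ ↑ ∷ ↓ ∷ ↓ ∷ []) []
  capN' = cap↑↓ ∘ (id↑ ⊗ (cap↑↓ ⊗ id↓))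

  -- X rotated by 180° using the cups/caps on the left resp. right
  XR : Mor (↓ ∷ ↓ ∷ []) (↓ ∷ ↓ ∷ [])
  XR = (capN ⊗ idm (↓ ∷ ↓ ∷ [])) ∘ (idm (↓ ∷ ↓ ∷ []) ⊗ (X ⊗ idm (↓ ∷ ↓ ∷ []))) ∘ (idm (↓ ∷ ↓ ∷ []) ⊗ cupN)
  XL : Mor (↓ ∷ ↓ ∷ []) (↓ ∷ ↓ ∷ [])
  XL = (idm (↓ ∷ ↓ ∷ []) ⊗ capN') ∘ ((idm (↓ ∷ ↓ ∷ []) ⊗ X) ⊗ idm (↓ ∷ ↓ ∷ [])) ∘ (cupN' ⊗ idm (↓ ∷ ↓ ∷ []))

  -- sideways crossings  Q₊⊗Q₋ → Q₋⊗Q₊  and  Q₋⊗Q₊ → Q₊⊗Q₋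
  Y₊₋ : Mor (↑ ∷ ↓ ∷ []) (↓ ∷ ↑ ∷ [])
  Y₊₋ = (id↓ ⊗ (id↑ ⊗ cap↑↓)) ∘ (id↓ ⊗ (X ⊗ id↓)) ∘ (cup↓↑ ⊗ idm (↑ ∷ ↓ ∷ []))
  Y₋₊ : Mor (↓ ∷ ↑ ∷ []) (↑ ∷ ↓ ∷ [])
  Y₋₊ = (cap↓↑ ⊗ idm (↑ ∷ ↓ ∷ [])) ∘ (id↓ ⊗ (X ⊗ id↓)) ∘ (idm (↓ ∷ ↑ ∷ []) ⊗ cup↑↓)

  leftCurl : Mor (↑ ∷ []) (↑ ∷ [])
  leftCurl = (cap↓↑ ⊗ id↑) ∘ (id↓ ⊗ X) ∘ (cup↓↑ ⊗ id↑)

  -- the dot x: upward strand with a curl on its right-hand side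
  dot : Mor (↑ ∷ []) (↑ ∷ [])
  dot = (id↑ ⊗ cap↑↓) ∘ (X ⊗ id↓) ∘ (id↑ ⊗ cup↑↓)

  infix 4 _≈_
  data _≈_ : ∀ {a b} → Mor a b → Mor a b → Set (c ⊔ ℓ) where
    ≈-refl  : ∀ {a b} {f : Mor a b} → f ≈ f
    ≈-sym   : ∀ {a b} {f g : Mor a b} → f ≈ g → g ≈ f
    ≈-trans : ∀ {a b} {f g h : Mor a b} → f ≈ g → g ≈ h → f ≈ h
    ∘-cong  : ∀ {a b d} {f f' : Mor b d} {g g' : Mor a b} → f ≈ f' → g ≈ g' → f ∘ g ≈ f' ∘ g'
    ⊗-cong  : ∀ {a b a' b'} {f f' : Mor a b} {g g' : Mor a' b'} → f ≈ f' → g ≈ g' → f ⊗ g ≈ f' ⊗ g'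
    +-cong  : ∀ {a b} {f f' g g' : Mor a b} → f ≈ f' → g ≈ g' → f +ₘ g ≈ f' +ₘ g'
    ·-cong  : ∀ {a b} {r s : K} {f g : Mor a b} → r ≈ᴿ s → f ≈ g → r · f ≈ s · g
    +-assoc : ∀ {a b} (f g h : Mor a b) → (f +ₘ g) +ₘ h ≈ f +ₘ (g +ₘ h)
    +-comm  : ∀ {a b} (f g : Mor a b) → f +ₘ g ≈ g +ₘ f
    +-idˡ   : ∀ {a b} (f : Mor a b) → zer +ₘ f ≈ f
    +-invˡ  : ∀ {a b} (f : Mor a b) → ((-ᴿ 1ᴿ) · f) +ₘ f ≈ zer
    ·-distˡ : ∀ {a b} (r : K) (f g : Mor a b) → r · (f +ₘ g) ≈ r · f +ₘ r · g
    ·-distʳ : ∀ {a b} (r s : K) (f : Mor a b) → (r +ᴿ s) · f ≈ r · f +ₘ s · f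
    ·-assoc : ∀ {a b} (r s : K) (f : Mor a b) → (r *ᴿ s) · f ≈ r · (s · f)
    ·-id    : ∀ {a b} (f : Mor a b) → 1ᴿ · f ≈ f
    ∘-distˡ : ∀ {a b d} (h : Mor b d) (f g : Mor a b) → h ∘ (f +ₘ g) ≈ h ∘ f +ₘ h ∘ g
    ∘-distʳ : ∀ {a b d} (f g : Mor b d) (h : Mor a b) → (f +ₘ g) ∘ h ≈ f ∘ h +ₘ g ∘ h
    ∘-·ˡ    : ∀ {a b d} (r : K) (f : Mor b d) (g : Mor a b) → (r · f) ∘ g ≈ r · (f ∘ g)
    ∘-·ʳ    : ∀ {a b d} (r : K) (f : Mor b d) (g : Mor a b) → f ∘ (r · g) ≈ r · (f ∘ g)
    ∘-zerˡ  : ∀ {a b d} (g : Mor a b) → zer {b} {d} ∘ g ≈ zer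
    ∘-zerʳ  : ∀ {a b d} (f : Mor b d) → f ∘ zer {a} {b} ≈ zer
    ⊗-distˡ : ∀ {a b a' b'} (h : Mor a b) (f g : Mor a' b') → h ⊗ (f +ₘ g) ≈ h ⊗ f +ₘ h ⊗ g
    ⊗-distʳ : ∀ {a b a' b'} (f g : Mor a b) (h : Mor a' b') → (f +ₘ g) ⊗ h ≈ f ⊗ h +ₘ g ⊗ h
    ⊗-·ˡ    : ∀ {a b a' b'} (r : K) (f : Mor a b) (g : Mor a' b') → (r · f) ⊗ g ≈ r · (f ⊗ g)
    ⊗-·ʳ    : ∀ {a b a' b'} (r : K) (f : Mor a b) (g : Mor a' b') → f ⊗ (r · g) ≈ r · (f ⊗ g)
    ⊗-zerˡ  : ∀ {a b a' b'} (g : Mor a' b') → zer {a} {b} ⊗ g ≈ zer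
    ⊗-zerʳ  : ∀ {a b a' b'} (f : Mor a b) → f ⊗ zer {a'} {b'} ≈ zer
    ∘-assoc : ∀ {a b d e} (h : Mor d e) (g : Mor b d) (f : Mor a b) → (h ∘ g) ∘ f ≈ h ∘ (g ∘ f)
    ∘-idˡ   : ∀ {a b} (f : Mor a b) → idm b ∘ f ≈ f
    ∘-idʳ   : ∀ {a b} (f : Mor a b) → f ∘ idm a ≈ f
    ⊗-assoc : ∀ {a b a' b' a'' b''} (f : Mor a b) (g : Mor a' b') (h : Mor a'' b'') →
              castM (++-assoc a a' a'') (++-assoc b b' b'') ((f ⊗ g) ⊗ h) ≈ f ⊗ (g ⊗ h)
    ⊗-idˡ   : ∀ {a b} (f : Mor a b) → idm [] ⊗ f ≈ f
    ⊗-idʳ   : ∀ {a b} (f : Mor a b) → castM (++-identityʳ a) (++-identityʳ b) (f ⊗ idm []) ≈ f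
    ⊗-idm   : ∀ (a a' : Obj) → idm a ⊗ idm a' ≈ idm (a ++ a')
    interchange : ∀ {a b d a' b' d'} (f : Mor b d) (f' : Mor a b) (g : Mor b' d') (g' : Mor a' b') →
              (f ⊗ g) ∘ (f' ⊗ g') ≈ (f ∘ f') ⊗ (g ∘ g')
    -- planar isotopy: zigzag identities for both dualities ...
    zigzag₁ : (id↑ ⊗ cap↓↑) ∘ (cup↑↓ ⊗ id↑) ≈ id↑
    zigzag₂ : (cap↓↑ ⊗ id↓) ∘ (id↓ ⊗ cup↑↓) ≈ id↓
    zigzag₃ : (cap↑↓ ⊗ id↑) ∘ (id↑ ⊗ cup↓↑) ≈ id↑
    zigzag₄ : (id↓ ⊗ cap↑↓) ∘ (cup↓↑ ⊗ id↓) ≈ id↓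
    -- ... and cyclicity of the crossing (its two 180° rotations agree)
    cyclic  : XR ≈ XL
    -- Khovanov's local relations (1)–(6)
    rel1    : X ∘ X ≈ idm (↑ ∷ ↑ ∷ [])
    rel2    : (X ⊗ id↑) ∘ (id↑ ⊗ X) ∘ (X ⊗ id↑) ≈ (id↑ ⊗ X) ∘ (X ⊗ id↑) ∘ (id↑ ⊗ X)
    rel3    : Y₋₊ ∘ Y₊₋ ≈ idm (↑ ∷ ↓ ∷ [])
    rel4    : Y₊₋ ∘ Y₋₊ ≈ idm (↓ ∷ ↑ ∷ []) +ₘ (-ᴿ 1ᴿ) · (cup↓↑ ∘ cap↓↑)
    rel5    : cap↓↑ ∘ cup↓↑ ≈ idm []
    rel6    : leftCurl ≈ zer

  dotPow : ℕ → Mor (↑ ∷ []) (↑ ∷ [])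
  dotPow zero = id↑
  dotPow (suc k) = dot ∘ dotPow k

  ntimes : ∀ {a b} → ℕ → Mor a b → Mor a b
  ntimes zero f = zer
  ntimes (suc m) f = f +ₘ ntimes m f

  sumM : ∀ {a b} → List (Mor a b) → Mor a b
  sumM = foldr _+ₘ_ zer

  -- crossing of strands i+1, i+2 in Q₊^{⊗(n'+1)}  (image of s_{i+1})
  crossAt : ∀ {n'} → Fin n' → Mor (ups (suc n')) (ups (suc n'))
  crossAt {suc m} zero = X ⊗ idm (ups m)
  crossAt {suc m} (suc i) = id↑ ⊗ crossAt {m} i

  -- φ applied to the product of a word
  crossW : ∀ {n'} → Word n' → Mor (ups (suc n')) (ups (suc n'))
  crossW {n'} [] = idm (ups (suc n'))
  crossW (i ∷ w) = crossAt i ∘ crossW w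

  -- nested clockwise cups / caps: the j-th ↑ is joined to the j-th ↓
  -- counted from the outside (so the n'-th pair is innermost)
  cupNest : (n' : ℕ) → Mor [] (ups n' ++ downs n')
  cupNest zero = idm []
  cupNest (suc m) = castM refl (cong-lemma m) ((id↑ ⊗ (cupNest m ⊗ id↓)) ∘ cup↑↓)
    where
    cong-lemma : (m : ℕ) → ↑ ∷ ((ups m ++ downs m) ++ (↓ ∷ [])) ≡ ups (suc m) ++ downs (suc m)
    cong-lemma m rewrite ++-assoc (ups m) (downs m) (↓ ∷ []) | downs-snoc m = refl

  capNest : (n' : ℕ) → Mor (ups n' ++ downs n') []
  capNest zero = idm []
  capNest (suc m) = castM (cong-lemma m) refl (cap↑↓ ∘ (id↑ ⊗ (capNest m ⊗ id↓)))
    where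
    cong-lemma : (m : ℕ) → ↑ ∷ ((ups m ++ downs m) ++ (↓ ∷ [])) ≡ ups (suc m) ++ downs (suc m)
    cong-lemma m rewrite ++-assoc (ups m) (downs m) (↓ ∷ []) | downs-snoc m = refl

  -- partial closure Tr' : End(Q₊^{⊗(n'+1)}) → End(Q₊): strands 2..n'+1 are
  -- closed by clockwise arcs to the right, the last one innermost.
  Tr' : ∀ {n'} → Mor (ups (suc n')) (ups (suc n')) → Mor (↑ ∷ []) (↑ ∷ [])
  Tr' {n'} f = (id↑ ⊗ capNest n') ∘ (f ⊗ idm (downs n')) ∘ (id↑ ⊗ cupNest n')

{-# OPTIONS --safe #-}

-- The affine Hecke relation x ⊗ 1 = X (1 ⊗ x) X + X moves a dot from the open strand to the innermost
-- closed one, where it opens up to a new closed strand.  Hence, for σ ∈ S_n,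
--   x Tr'(σ) = Tr'((1 n+1) σ) + Σ_{j = 2..n} Tr'((1 j) σ),
-- and x^k is a sum of closures of products of k transpositions.  By cyclicity of the crossing Tr' is
-- invariant under conjugation by the stabiliser of 1.  A product of k transpositions is conjugate under
-- that stabiliser to a word of length at most k, and ≡ k mod 2: Hurwitz moves leave at most one
-- transposition (1 a) in front of transpositions of {2, …, n}; conjugation makes it s_1, and one
-- continues with the remaining transpositions in S_{n-1}.  Finally, by the Coxeter presentation, the
-- closure of a word depends only on its product in S_n.
module Submission where

open import Defs
open import Level using (_⊔_)
open import Algebra.Bundles using (CommutativeRing)
open import Data.Bool using (Bool; true; false)
open import Data.Nat using (ℕ; zero; suc; _+_; _≤_; _%_; z≤n; s≤s)
import Data.Nat.Properties as ℕ
open import Data.Nat.Properties using (≤-refl; ≤-trans; m≤n⇒m≤1+n)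
open import Data.Nat.DivMod using (%-distribˡ-+; [m+n]%n≡m%n)
open import Data.Fin using (Fin; zero; suc; inject₁; fromℕ; _≟_)
open import Data.Fin.Properties using (suc-injective)
open import Data.List using (List; []; _∷_; _++_; [_]; map; concatMap; upTo; tabulate; allFin; length)
open import Data.List.Properties using (++-assoc; ++-identityʳ; map-++; map-∘; map-tabulate; map-concatMap; concatMap-cong; length-map; length-++)
open import Data.List.Membership.Propositional using (_∈_)
open import Data.List.Membership.Propositional.Properties using (∈-map⁺; ∈-map⁻; ∈-concatMap⁺; ∈-allFin; ∈-filter⁺; ∈-upTo⁺)
open import Data.List.Relation.Unary.All as All using (All; []; _∷_)
import Data.List.Relation.Unary.All.Properties as All
open import Data.List.Relation.Unary.Any as Any using (here; there)
open import Data.List.Relation.Unary.AllPairs as AllPairs using ([]; _∷_)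
import Data.List.Relation.Unary.AllPairs.Properties as AllPairs
open import Data.List.Relation.Unary.Unique.Propositional using (Unique)
import Data.List.Relation.Unary.Unique.Propositional.Properties as Unique
open import Data.Product using (Σ; ∃; ∃₂; _×_; _,_; proj₁; proj₂)
import Data.Product.Properties as Σ
open import Data.Vec as Vec using (Vec; lookup; toList)
import Data.Vec.Properties as Vec
open import Data.Vec.Properties using (lookup-allFin; lookup-map; toList-map; ∷-injectiveˡ; ∷-injectiveʳ)
open import Relation.Nullary using (¬_; yes; no; does; contradiction)
open import Relation.Binary.Definitions using (DecidableEquality)
open import Relation.Binary.PropositionalEquality as ≡ using (_≡_; _≢_; refl; sym; trans; cong; cong₂; subst)

-- As a word in the simple transpositions, (1 j) has length 2j - 3, so a product of k transpositions
-- in the expansion can have Coxeter length larger than k. The bound is therefore obtained only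
-- after conjugation, and as the first strand stays open, only conjugation by the stabiliser of 1 is
-- available. This stabiliser acts transitively on the transpositions moving 1, which is why at most
-- one of them may survive and why it can be made a single letter. Identities between products of
-- transpositions are checked by evaluating permutations at points. Diagrams know only the Coxeter
-- relations, so completeness of the presentation is what carries such identities over to them; it
-- also makes the result independent of the word chosen for each permutation. On the diagram side,
-- objects are lists, and the usual rebracketings of strands hold only propositionally. Crossings
-- and arcs are therefore defined with an arbitrary word of strands to their right, in a form for
-- which most objects agree by computation.

module Permutations where

  open ≡.≡-Reasoning

  private variable
    n : ℕ

  -- Words in simple transpositions acting on points

  swapF-suc : (i : Fin n) (x : Fin (suc n)) → swapF (suc i) (suc x) ≡ suc (swapF i x)
  swapF-suc i x with does (x ≟ inject₁ i) | does (x ≟ suc i)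
  ... | true  | _     = refl
  ... | false | true  = refl
  ... | false | false = refl

  swapF-suc-suc : (i : Fin n) (x : Fin (suc n)) → swapF (suc (suc i)) (suc (suc x)) ≡ suc (suc (swapF i x))
  swapF-suc-suc i x = trans (swapF-suc (suc i) (suc x)) (cong suc (swapF-suc i x))

  swapF-involutive : (i : Fin n) (x : Fin (suc n)) → swapF i (swapF i x) ≡ x
  swapF-involutive zero    zero          = refl
  swapF-involutive zero    (suc zero)    = refl
  swapF-involutive zero    (suc (suc x)) = refl
  swapF-involutive (suc i) zero          = refl
  swapF-involutive (suc i) (suc x)       = begin
    swapF (suc i) (swapF (suc i) (suc x)) ≡⟨ cong (swapF (suc i)) (swapF-suc i x) ⟩
    swapF (suc i) (suc (swapF i x))       ≡⟨ swapF-suc i (swapF i x) ⟩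
    suc (swapF i (swapF i x))             ≡⟨ cong suc (swapF-involutive i x) ⟩
    suc x                                 ∎

  act : Word n → Fin (suc n) → Fin (suc n)
  act []      x = x
  act (i ∷ w) x = swapF i (act w x)

  infix 4 _≐_
  -- A record rather than a bare family of equations, so that `w` and `v` can be inferred from the
  -- type of a proof; they could not be recovered from the values of `act`.
  record _≐_ (w v : Word n) : Set where
    constructor ext
    field eval : ∀ x → act w x ≡ act v x
  open _≐_

  ≐-trans : {w v t : Word n} → w ≐ v → v ≐ t → w ≐ t
  ≐-trans p q = ext λ x → trans (eval p x) (eval q x)

  ≡⇒≐ : {w v : Word n} → w ≡ v → w ≐ v
  ≡⇒≐ refl = ext λ _ → refl

  act-++ : (w v : Word n) → ∀ x → act (w ++ v) x ≡ act w (act v x)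
  act-++ []      v x = refl
  act-++ (i ∷ w) v x = cong (swapF i) (act-++ w v x)

  ++-≐ : {w w' v v' : Word n} → w ≐ w' → v ≐ v' → w ++ v ≐ w' ++ v'
  ++-≐ {w = w} {w'} {v} {v'} p q = ext λ x → begin
    act (w ++ v) x     ≡⟨ act-++ w v x ⟩
    act w (act v x)    ≡⟨ trans (eval p _) (cong (act w') (eval q x)) ⟩
    act w' (act v' x)  ≡⟨ act-++ w' v' x ⟨
    act (w' ++ v') x   ∎

  ++-≐ˡ : (w : Word n) {v v' : Word n} → v ≐ v' → w ++ v ≐ w ++ v'
  ++-≐ˡ w = ++-≐ (≡⇒≐ {w = w} refl)

  ++-≐ʳ : {w w' : Word n} (v : Word n) → w ≐ w' → w ++ v ≐ w' ++ v
  ++-≐ʳ v p = ++-≐ p (≡⇒≐ {w = v} refl)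

  act-map-suc-zero : (w : Word n) → act (map suc w) zero ≡ zero
  act-map-suc-zero []      = refl
  act-map-suc-zero (i ∷ w) = cong (swapF (suc i)) (act-map-suc-zero w)

  act-map-suc : (w : Word n) → ∀ x → act (map suc w) (suc x) ≡ suc (act w x)
  act-map-suc []      x = refl
  act-map-suc (i ∷ w) x = trans (cong (swapF (suc i)) (act-map-suc w x)) (swapF-suc i (act w x))

  map-suc-≐ : {w v : Word n} → w ≐ v → map suc w ≐ map suc v
  map-suc-≐ {w = w} {v} p = ext λ where
    zero    → trans (act-map-suc-zero w) (sym (act-map-suc-zero v))
    (suc x) → trans (act-map-suc w x) (trans (cong suc (eval p x)) (sym (act-map-suc v x)))

  act-injective : (w : Word n) → ∀ {x y} → act w x ≡ act w y → x ≡ y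
  act-injective []      p = p
  act-injective (i ∷ w) p = act-injective w
    (trans (sym (swapF-involutive i _)) (trans (cong (swapF i) p) (swapF-involutive i _)))

  -- Completeness of the Coxeter presentation

  -- The Coxeter presentation of the symmetric group: the defining relations at the first letters,
  -- closed under shifting all letters.
  infix 4 _~_
  data _~_ : Word n → Word n → Set where
    ~-refl   : {w : Word n} → w ~ w
    ~-sym    : {w v : Word n} → w ~ v → v ~ w
    ~-trans  : {w v t : Word n} → w ~ v → v ~ t → w ~ t
    ~-++     : {w w' v v' : Word n} → w ~ w' → v ~ v' → w ++ v ~ w' ++ v'
    ~-shift  : {w v : Word n} → w ~ v → map suc w ~ map suc v
    ~-square : zero {n} ∷ zero ∷ [] ~ []
    ~-braid  : zero {suc n} ∷ suc zero ∷ zero ∷ [] ~ suc zero ∷ zero ∷ suc zero ∷ []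
    ~-far    : (i : Fin n) → zero ∷ suc (suc i) ∷ [] ~ suc (suc i) ∷ zero ∷ []

  ~-act : {w v : Word n} → w ~ v → w ≐ v
  ~-act ~-refl        = ≡⇒≐ refl
  ~-act (~-sym p)     = ext λ x → sym (eval (~-act p) x)
  ~-act (~-trans p q) = ≐-trans (~-act p) (~-act q)
  ~-act (~-++ p q)    = ++-≐ (~-act p) (~-act q)
  ~-act (~-shift p)   = map-suc-≐ (~-act p)
  ~-act ~-square      = ext (swapF-involutive zero)
  ~-act ~-braid       = ext λ where
    zero                → refl
    (suc zero)          → refl
    (suc (suc zero))    → refl
    (suc (suc (suc x))) → refl
  ~-act (~-far i)     = ext λ where
    zero          → refl
    (suc zero)    → refl
    (suc (suc x)) → trans (cong (swapF zero) (swapF-suc-suc i x)) (sym (swapF-suc-suc i x))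

  -- Each defining relation changes the length by 0 or 2. Together with completeness this makes the
  -- sign of a permutation well defined, without counting inversions.
  ~-parity : {w v : Word n} → w ~ v → length w % 2 ≡ length v % 2
  ~-parity ~-refl        = refl
  ~-parity (~-sym p)     = sym (~-parity p)
  ~-parity (~-trans p q) = trans (~-parity p) (~-parity q)
  ~-parity (~-++ {w = w} {w'} {v} {v'} p q) = begin
    length (w ++ v) % 2                       ≡⟨ cong (_% 2) (length-++ w) ⟩
    (length w + length v) % 2                 ≡⟨ %-distribˡ-+ (length w) (length v) 2 ⟩
    (length w % 2 + length v % 2) % 2         ≡⟨ cong₂ (λ a b → (a + b) % 2) (~-parity p) (~-parity q) ⟩
    (length w' % 2 + length v' % 2) % 2       ≡⟨ %-distribˡ-+ (length w') (length v') 2 ⟨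
    (length w' + length v') % 2               ≡⟨ cong (_% 2) (length-++ w') ⟨
    length (w' ++ v') % 2                     ∎
  ~-parity (~-shift {w = w} {v} p) = begin
    length (map suc w) % 2 ≡⟨ cong (_% 2) (length-map suc w) ⟩
    length w % 2           ≡⟨ ~-parity p ⟩
    length v % 2           ≡⟨ cong (_% 2) (length-map suc v) ⟨
    length (map suc v) % 2 ∎
  ~-parity ~-square  = refl
  ~-parity ~-braid   = refl
  ~-parity (~-far i) = refl

  ≡⇒~ : {w v : Word n} → w ≡ v → w ~ v
  ≡⇒~ refl = ~-refl

  ~-far* : (w : Word n) → zero ∷ map suc (map suc w) ~ map suc (map suc w) ++ [ zero ]
  ~-far* []      = ~-refl
  ~-far* (i ∷ w) = ~-trans (~-++ (~-far i) ~-refl) (~-++ {w = [ suc (suc i) ]} ~-refl (~-far* w))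

  -- chain j = s_{j-1} ⋯ s_1 s_0 are the representatives of the cosets of the stabiliser of 0.
  chain : Fin (suc n) → Word n
  chain         zero    = []
  chain {suc n} (suc j) = map suc (chain j) ++ [ zero ]

  act-chain : (j : Fin (suc n)) → act (chain j) zero ≡ j
  act-chain         zero    = refl
  act-chain {suc n} (suc j) = begin
    act (map suc (chain j) ++ [ zero ]) zero ≡⟨ act-++ (map suc (chain j)) [ zero ] zero ⟩
    act (map suc (chain j)) (suc zero)       ≡⟨ act-map-suc (chain j) zero ⟩
    suc (act (chain j) zero)                 ≡⟨ cong suc (act-chain j) ⟩
    suc j                                    ∎

  -- Left multiplication by a generator permutes the cosets of the stabiliser of 0. The point is
  -- that the relations suffice to find the new representative, leaving a remainder in letters that
  -- fix 0. The essential case is `zero` against a chain of at least two letters: it commutes past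
  -- all but the last two, and there the braid relation applies.
  ∷-chain : (i : Fin (suc n)) (j : Fin (suc (suc n))) → ∃₂ λ j' v → i ∷ chain j ~ chain j' ++ map suc v
  ∷-chain zero    zero       = suc zero , [] , ~-refl
  ∷-chain (suc i) zero       = zero , [ i ] , ~-refl
  ∷-chain zero    (suc zero) = zero , [] , ~-square
  ∷-chain {suc n} zero (suc (suc j)) = suc (suc j) , [ zero ] ,
    ~-trans (≡⇒~ expand)
      (~-trans (~-++ (~-far* (chain j)) ~-refl)
        (~-trans (≡⇒~ (++-assoc C [ zero ] _)) (~-trans (~-++ {w = C} ~-refl ~-braid) (≡⇒~ contract))))
    where
    C : Word (suc (suc n))
    C = map suc (map suc (chain j))

    inner : map suc (chain (suc j)) ≡ C ++ [ suc zero ]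
    inner = map-++ suc (map suc (chain j)) [ zero ]

    expand : zero ∷ chain (suc (suc j)) ≡ (zero ∷ C) ++ suc zero ∷ zero ∷ []
    expand = cong (zero ∷_) (trans (cong (_++ [ zero ]) inner) (++-assoc C _ _))

    contract : C ++ suc zero ∷ zero ∷ suc zero ∷ [] ≡ chain (suc (suc j)) ++ [ suc zero ]
    contract = sym (trans (cong (λ w → (w ++ [ zero ]) ++ [ suc zero ]) inner)
      (trans (cong (_++ [ suc zero ]) (++-assoc C _ _)) (++-assoc C _ _)))
  ∷-chain {suc n} (suc i) (suc j) with ∷-chain i j
  ... | j' , v , p = suc j' , map suc v ,
    ~-trans (~-++ (~-shift p) ~-refl)
      (~-trans (≡⇒~ (trans (cong (_++ [ zero ]) (map-++ suc (chain j') (map suc v))) (++-assoc C' _ _)))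
        (~-trans (~-++ {w = C'} ~-refl (~-sym (~-far* v))) (≡⇒~ (sym (++-assoc C' _ _)))))
    where C' = map suc (chain j')

  normalForm : (w : Word (suc n)) → ∃₂ λ j v → w ~ chain j ++ map suc v
  normalForm []      = zero , [] , ~-refl
  normalForm (i ∷ w) with normalForm w
  ... | j , v , p with ∷-chain i j
  ...   | j' , v' , q = j' , v' ++ v ,
    ~-trans (~-++ {w = [ i ]} ~-refl p)
      (~-trans (~-++ q ~-refl)
        (≡⇒~ (trans (++-assoc (chain j') _ _) (cong (chain j' ++_) (sym (map-++ suc v' v))))))

  -- The image of 0 determines the coset representative in the normal form. Cancelling it leaves two
  -- words in the shifted letters with the same action, to which induction on `n` applies.
  ≐⇒~ : ∀ {n} (w v : Word n) → w ≐ v → w ~ v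
  ≐⇒~ {zero}  []  []  p = ~-refl
  ≐⇒~ {suc n} w v p with normalForm w | normalForm v
  ... | j , w' , e | k , v' , f = ~-trans e (~-trans (match j≡k) (~-sym f))
    where
    head : ∀ j (t : Word n) → act (chain j ++ map suc t) zero ≡ j
    head j t = trans (act-++ (chain j) _ zero) (trans (cong (act (chain j)) (act-map-suc-zero t)) (act-chain j))

    pe : chain j ++ map suc w' ≐ chain k ++ map suc v'
    pe = ≐-trans (~-act (~-sym e)) (≐-trans p (~-act f))

    j≡k : j ≡ k
    j≡k = trans (sym (head j w')) (trans (eval pe zero) (head k v'))

    match : j ≡ k → chain j ++ map suc w' ~ chain k ++ map suc v'
    match refl = ~-++ {w = chain j} ~-refl (~-shift (≐⇒~ w' v' (ext λ x → suc-injective (begin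
      suc (act w' x)           ≡⟨ act-map-suc w' x ⟨
      act (map suc w') (suc x) ≡⟨ act-injective (chain j) (trans (sym (act-++ (chain j) _ _)) (trans (eval pe (suc x)) (act-++ (chain j) _ _))) ⟩
      act (map suc v') (suc x) ≡⟨ act-map-suc v' x ⟩
      suc (act v' x)           ∎))))

  -- Transpositions as words

  -- star j is a word for the transposition (0 j+1).
  star : Fin n → Word n
  star zero    = [ zero ]
  star (suc j) = zero ∷ map suc (star j) ++ [ zero ]

  act-star-zero : (j : Fin n) → act (star j) zero ≡ suc j
  act-star-zero zero    = refl
  act-star-zero (suc j) = cong (swapF zero) (begin
    act (map suc (star j) ++ [ zero ]) zero ≡⟨ act-++ (map suc (star j)) _ zero ⟩
    act (map suc (star j)) (suc zero)       ≡⟨ act-map-suc (star j) zero ⟩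
    suc (act (star j) zero)                 ≡⟨ cong suc (act-star-zero j) ⟩
    suc (suc j)                             ∎)

  star-involutive : (j : Fin n) → star j ++ star j ≐ []
  star-involutive zero    = ext (swapF-involutive zero)
  star-involutive (suc j) = ext λ x → begin
    act (star (suc j) ++ star (suc j)) x
      ≡⟨ trans (act-++ (star (suc j)) _ x) (trans (conj _) (cong (λ y → s (act J (s y))) (conj x))) ⟩
    s (act J (s (s (act J (s x)))))
      ≡⟨ cong (λ y → s (act J y)) (swapF-involutive zero _) ⟩
    s (act J (act J (s x)))
      ≡⟨ cong s (trans (sym (act-++ J J (s x))) (eval (≐-trans (≡⇒≐ (sym (map-++ suc (star j) (star j))))
          (map-suc-≐ (star-involutive j))) (s x))) ⟩
    s (s x)
      ≡⟨ swapF-involutive zero x ⟩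
    x ∎
    where
    J = map suc (star j)
    s = swapF zero
    conj : ∀ y → act (star (suc j)) y ≡ s (act J (s y))
    conj y = cong s (act-++ J [ zero ] y)

  act-star-suc : (j : Fin n) → act (star j) (suc j) ≡ zero
  act-star-suc j = begin
    act (star j) (suc j)               ≡⟨ cong (act (star j)) (act-star-zero j) ⟨
    act (star j) (act (star j) zero)   ≡⟨ act-++ (star j) (star j) zero ⟨
    act (star j ++ star j) zero        ≡⟨ eval (star-involutive j) zero ⟩
    zero                               ∎

  act-star-other : (j : Fin n) {x : Fin n} → x ≢ j → act (star j) (suc x) ≡ suc x
  act-star-other zero    {zero}  x≢j = contradiction refl x≢j
  act-star-other zero    {suc x} x≢j = refl
  act-star-other (suc j) {zero}  x≢j = cong (swapF zero)
    (trans (act-++ (map suc (star j)) _ (suc zero)) (act-map-suc-zero (star j)))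
  act-star-other (suc j) {suc x} x≢j = cong (swapF zero) (begin
    act (map suc (star j) ++ [ zero ]) (suc (suc x)) ≡⟨ act-++ (map suc (star j)) _ _ ⟩
    act (map suc (star j)) (suc (suc x))             ≡⟨ act-map-suc (star j) (suc x) ⟩
    suc (act (star j) (suc x))                       ≡⟨ cong suc (act-star-other j (λ e → x≢j (cong suc e))) ⟩
    suc (suc x)                                      ∎)

  -- Conjugating (0 a+1) by a permutation that fixes 0 only moves its other point. Written without
  -- inverses, so that it can be used to push `star a` to the left.
  map-suc-star : (w : Word n) (a : Fin (suc n)) → map suc w ++ star a ≐ star (act w a) ++ map suc w
  map-suc-star w a = ext λ x →
    trans (act-++ (map suc w) _ x) (trans (pointwise x) (sym (act-++ (star (act w a)) _ x)))
    where
    pointwise : ∀ x → act (map suc w) (act (star a) x) ≡ act (star (act w a)) (act (map suc w) x)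
    pointwise zero = begin
      act (map suc w) (act (star a) zero)             ≡⟨ cong (act (map suc w)) (act-star-zero a) ⟩
      act (map suc w) (suc a)                         ≡⟨ act-map-suc w a ⟩
      suc (act w a)                                   ≡⟨ act-star-zero (act w a) ⟨
      act (star (act w a)) zero                       ≡⟨ cong (act (star (act w a))) (act-map-suc-zero w) ⟨
      act (star (act w a)) (act (map suc w) zero)     ∎
    pointwise (suc x) with x ≟ a
    ... | yes refl = begin
      act (map suc w) (act (star x) (suc x))          ≡⟨ cong (act (map suc w)) (act-star-suc x) ⟩
      act (map suc w) zero                            ≡⟨ act-map-suc-zero w ⟩
      zero                                            ≡⟨ act-star-suc (act w x) ⟨
      act (star (act w x)) (suc (act w x))            ≡⟨ cong (act (star (act w x))) (act-map-suc w x) ⟨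
      act (star (act w x)) (act (map suc w) (suc x))  ∎
    ... | no x≢a = begin
      act (map suc w) (act (star a) (suc x))          ≡⟨ cong (act (map suc w)) (act-star-other a x≢a) ⟩
      act (map suc w) (suc x)                         ≡⟨ act-map-suc w x ⟩
      suc (act w x)                                   ≡⟨ act-star-other (act w a) (λ e → x≢a (act-injective w e)) ⟨
      act (star (act w a)) (suc (act w x))            ≡⟨ cong (act (star (act w a))) (act-map-suc w x) ⟨
      act (star (act w a)) (act (map suc w) (suc x))  ∎

  -- Indexed by the smaller moved point: i applications of `shift` to `swap0 j` give the
  -- transposition of i and i+j+1. The outermost constructor thus decides whether 0 is moved, which
  -- is the case distinction of `gather`.
  data Transposition : ℕ → Set where
    swap0 : Fin n → Transposition n
    shift : Transposition n → Transposition (suc n)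

  word : Transposition n → Word n
  word (swap0 j) = star j
  word (shift t) = map suc (word t)

  words : List (Transposition n) → Word n
  words = concatMap word

  between : (a b : Fin (suc n)) → a ≢ b → Transposition n
  between zero    zero    a≢b = contradiction refl a≢b
  between zero    (suc b) a≢b = swap0 b
  between (suc a) zero    a≢b = swap0 a
  between {suc n} (suc a) (suc b) a≢b = shift (between a b (λ e → a≢b (cong suc e)))

  act-betweenˡ : (a b : Fin (suc n)) (a≢b : a ≢ b) → act (word (between a b a≢b)) a ≡ b
  act-betweenˡ zero    zero    a≢b = contradiction refl a≢b
  act-betweenˡ zero    (suc b) a≢b = act-star-zero b
  act-betweenˡ (suc a) zero    a≢b = act-star-suc a
  act-betweenˡ {suc n} (suc a) (suc b) a≢b = trans (act-map-suc (word (between a b _)) a) (cong suc (act-betweenˡ a b _))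

  act-betweenʳ : (a b : Fin (suc n)) (a≢b : a ≢ b) → act (word (between a b a≢b)) b ≡ a
  act-betweenʳ zero    zero    a≢b = contradiction refl a≢b
  act-betweenʳ zero    (suc b) a≢b = act-star-suc b
  act-betweenʳ (suc a) zero    a≢b = act-star-zero a
  act-betweenʳ {suc n} (suc a) (suc b) a≢b = trans (act-map-suc (word (between a b _)) b) (cong suc (act-betweenʳ a b _))

  act-between-other : (a b : Fin (suc n)) (a≢b : a ≢ b) → ∀ {x} → x ≢ a → x ≢ b → act (word (between a b a≢b)) x ≡ x
  act-between-other zero    zero    a≢b x≢a x≢b = contradiction refl a≢b
  act-between-other zero    (suc b) a≢b {zero}  x≢a x≢b = contradiction refl x≢a
  act-between-other zero    (suc b) a≢b {suc x} x≢a x≢b = act-star-other b (λ e → x≢b (cong suc e))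
  act-between-other (suc a) zero    a≢b {zero}  x≢a x≢b = contradiction refl x≢b
  act-between-other (suc a) zero    a≢b {suc x} x≢a x≢b = act-star-other a (λ e → x≢a (cong suc e))
  act-between-other {suc n} (suc a) (suc b) a≢b {zero}  x≢a x≢b = act-map-suc-zero (word (between a b _))
  act-between-other {suc n} (suc a) (suc b) a≢b {suc x} x≢a x≢b = trans (act-map-suc (word (between a b _)) x)
    (cong suc (act-between-other a b _ (λ e → x≢a (cong suc e)) (λ e → x≢b (cong suc e))))

  star-star : (a b : Fin (suc n)) (a≢b : a ≢ b) → star a ++ star b ≐ star b ++ map suc (word (between a b a≢b))
  star-star a b a≢b = ext λ x → trans (act-++ (star a) _ x) (trans (pointwise x) (sym (act-++ (star b) _ x)))
    where
    t = word (between a b a≢b)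
    pointwise : ∀ x → act (star a) (act (star b) x) ≡ act (star b) (act (map suc t) x)
    pointwise zero = begin
      act (star a) (act (star b) zero)        ≡⟨ cong (act (star a)) (act-star-zero b) ⟩
      act (star a) (suc b)                    ≡⟨ act-star-other a (λ e → a≢b (sym e)) ⟩
      suc b                                   ≡⟨ act-star-zero b ⟨
      act (star b) zero                       ≡⟨ cong (act (star b)) (act-map-suc-zero t) ⟨
      act (star b) (act (map suc t) zero)     ∎
    pointwise (suc x) with x ≟ a | x ≟ b
    ... | yes refl | _ = begin
      act (star x) (act (star b) (suc x))     ≡⟨ cong (act (star x)) (act-star-other b a≢b) ⟩
      act (star x) (suc x)                    ≡⟨ act-star-suc x ⟩
      zero                                    ≡⟨ act-star-suc b ⟨
      act (star b) (suc b)                    ≡⟨ cong (act (star b)) (trans (act-map-suc t x) (cong suc (act-betweenˡ x b a≢b))) ⟨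
      act (star b) (act (map suc t) (suc x))  ∎
    ... | no _ | yes refl = begin
      act (star a) (act (star x) (suc x))     ≡⟨ cong (act (star a)) (act-star-suc x) ⟩
      act (star a) zero                       ≡⟨ act-star-zero a ⟩
      suc a                                   ≡⟨ act-star-other x a≢b ⟨
      act (star x) (suc a)                    ≡⟨ cong (act (star x)) (trans (act-map-suc t x) (cong suc (act-betweenʳ a x a≢b))) ⟨
      act (star x) (act (map suc t) (suc x))  ∎
    ... | no x≢a | no x≢b = begin
      act (star a) (act (star b) (suc x))     ≡⟨ cong (act (star a)) (act-star-other b x≢b) ⟩
      act (star a) (suc x)                    ≡⟨ act-star-other a x≢a ⟩
      suc x                                   ≡⟨ act-star-other b x≢b ⟨
      act (star b) (suc x)                    ≡⟨ cong (act (star b)) (trans (act-map-suc t x) (cong suc (act-between-other a b a≢b x≢a x≢b))) ⟨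
      act (star b) (act (map suc t) (suc x))  ∎

  -- Shortening a product of transpositions up to conjugation

  infix 4 _≼_
  -- At most, and of the same parity: the two claims about lengths are carried through the argument
  -- as one.
  data _≼_ : ℕ → ℕ → Set where
    ≼-refl : ∀ {m} → m ≼ m
    ≼-step : ∀ {m k} → m ≼ k → m ≼ suc (suc k)

  ≼-trans : ∀ {m k l} → m ≼ k → k ≼ l → m ≼ l
  ≼-trans p ≼-refl     = p
  ≼-trans p (≼-step q) = ≼-step (≼-trans p q)

  ≼-suc : ∀ {m k} → m ≼ k → suc m ≼ suc k
  ≼-suc ≼-refl     = ≼-refl
  ≼-suc (≼-step p) = ≼-step (≼-suc p)

  ≼⇒≤ : ∀ {m k} → m ≼ k → m ≤ k
  ≼⇒≤ ≼-refl     = ≤-refl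
  ≼⇒≤ (≼-step p) = m≤n⇒m≤1+n (m≤n⇒m≤1+n (≼⇒≤ p))

  ≼⇒parity : ∀ {m k} → m ≼ k → m % 2 ≡ k % 2
  ≼⇒parity ≼-refl             = refl
  ≼⇒parity (≼-step {k = k} p) = trans (≼⇒parity p) (trans (sym ([m+n]%n≡m%n k 2)) (cong (_% 2) (ℕ.+-comm k 2)))

  data Gathered (ts : List (Transposition (suc n))) : Set where
    none : ∀ us   → words ts ≐ map suc (words us) → length us ≼ length ts → Gathered ts
    one  : ∀ a us → words ts ≐ star a ++ map suc (words us) → suc (length us) ≼ length ts → Gathered ts

  -- Transpositions moving 0 are pushed to the front by Hurwitz moves; two of them merge by
  -- (0 a)(0 b) = (0 b)(a b), or cancel if a = b.
  gather : (ts : List (Transposition (suc n))) → Gathered ts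
  gather [] = none [] (≡⇒≐ refl) ≼-refl
  gather (swap0 b ∷ ts) with gather ts
  ... | none us p l   = one b us (++-≐ˡ (star b) p) (≼-suc l)
  ... | one a us p l with b ≟ a
  ...   | yes refl = none us
    (≐-trans (++-≐ˡ (star b) p) (≐-trans (≡⇒≐ (sym (++-assoc (star b) (star b) _))) (++-≐ʳ (map suc (words us)) (star-involutive b))))
    -- The two cancelled factors account for one step of size 2.
    (≼-trans (≼-step ≼-refl) (≼-suc l))
  ...   | no b≢a   = one a (between b a b≢a ∷ us)
    (≐-trans (++-≐ˡ (star b) p) (≐-trans (≡⇒≐ (sym (++-assoc (star b) (star a) _)))
      (≐-trans (++-≐ʳ (map suc (words us)) (star-star b a b≢a))
        (≡⇒≐ (trans (++-assoc (star a) _ _) (cong (star a ++_) (sym (map-++ suc (word (between b a b≢a)) (words us)))))))))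
    (≼-suc l)
  gather (shift t ∷ ts) with gather ts
  ... | none us p l   = none (t ∷ us)
    (≐-trans (++-≐ˡ (map suc (word t)) p) (≡⇒≐ (sym (map-++ suc (word t) (words us))))) (≼-suc l)
  ... | one a us p l  = one (act (word t) a) (t ∷ us)
    (≐-trans (++-≐ˡ (map suc (word t)) p) (≐-trans (≡⇒≐ (sym (++-assoc (map suc (word t)) (star a) _)))
      (≐-trans (++-≐ʳ (map suc (words us)) (map-suc-star (word t) a))
        (≡⇒≐ (trans (++-assoc (star (act (word t) a)) _ _) (cong (star (act (word t) a) ++_) (sym (map-++ suc (word t) (words us)))))))))
    (≼-suc l)

  -- The transposition s_i t s_i, computed on codes rather than on words, so that conjugating a
  -- product preserves the number of its factors.
  conjugate : Fin n → Transposition n → Transposition n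
  conjugate zero    (swap0 zero)      = swap0 zero
  conjugate zero    (swap0 (suc a))   = shift (swap0 a)
  conjugate zero    (shift (swap0 a)) = swap0 (suc a)
  conjugate zero    (shift (shift t)) = shift (shift t)
  conjugate (suc i) (swap0 a)         = swap0 (swapF i a)
  conjugate (suc i) (shift t)         = shift (conjugate i t)

  conjugate-word : (i : Fin n) (t : Transposition n) → i ∷ word t ≐ word (conjugate i t) ++ [ i ]
  conjugate-word zero    (swap0 zero)      = ≡⇒≐ refl
  conjugate-word zero    (swap0 (suc a))   = ext λ x → swapF-involutive zero _
  conjugate-word zero    (shift (swap0 a)) = ext λ x → cong (swapF zero) (begin
    act A x                                  ≡⟨ cong (act A) (swapF-involutive zero x) ⟨
    act A (swapF zero (swapF zero x))        ≡⟨ act-++ A (zero ∷ zero ∷ []) x ⟨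
    act (A ++ zero ∷ zero ∷ []) x            ≡⟨ eval (≡⇒≐ (++-assoc A [ zero ] [ zero ])) x ⟨
    act ((A ++ [ zero ]) ++ [ zero ]) x      ∎)
    where A = map suc (star a)
  conjugate-word zero    (shift (shift t)) = ~-act (~-far* (word t))
  conjugate-word (suc i) (swap0 a)         = map-suc-star [ i ] a
  conjugate-word (suc i) (shift t)         =
    ≐-trans (map-suc-≐ (conjugate-word i t)) (≡⇒≐ (map-++ suc (word (conjugate i t)) [ i ]))

  conjugate-words : (i : Fin n) (ts : List (Transposition n)) → i ∷ words ts ≐ words (map (conjugate i) ts) ++ [ i ]
  conjugate-words i []       = ≡⇒≐ refl
  conjugate-words i (t ∷ ts) = ≐-trans (++-≐ʳ (words ts) (conjugate-word i t))
    (≐-trans (≡⇒≐ (++-assoc t' [ i ] (words ts)))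
      (≐-trans (++-≐ˡ t' (conjugate-words i ts)) (≡⇒≐ (sym (++-assoc t' _ _)))))
    where t' = word (conjugate i t)

  -- Equality in the symmetric group up to conjugation by the stabiliser of 0; closures are invariant under it.
  infix 4 _≃_
  data _≃_ : Word n → Word n → Set where
    ≃-act    : {w v : Word n} → w ≐ v → w ≃ v
    ≃-rotate : (i : Fin n) (w : Word (suc n)) → suc i ∷ w ≃ w ++ [ suc i ]
    ≃-trans  : {w v t : Word n} → w ≃ v → v ≃ t → w ≃ t

  ≃-shift : {w v : Word n} → w ≃ v → map suc w ≃ map suc v
  ≃-shift (≃-act p) = ≃-act (map-suc-≐ p)
  ≃-shift (≃-rotate i w)        = ≃-trans (≃-rotate (suc i) (map suc w)) (≃-act (≡⇒≐ (sym (map-++ suc w [ suc i ]))))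
  ≃-shift (≃-trans p q)         = ≃-trans (≃-shift p) (≃-shift q)

  -- A letter rotated in `w` fixes 0, so after the shift it fixes both 0 and 1 and commutes with
  -- s_0. It can therefore pass the leading `zero` before it is rotated. For this reason the
  -- recursion in `shorten` must be confined to conjugation by the stabiliser of 0 at every level.
  ≃-zero∷ : {w v : Word n} → w ≃ v → zero ∷ map suc w ≃ zero ∷ map suc v
  ≃-zero∷ (≃-act p)            = ≃-act (++-≐ˡ [ zero ] (map-suc-≐ p))
  ≃-zero∷ (≃-rotate i w)        = ≃-trans (≃-act (++-≐ʳ (map suc w) (~-act (~-far i))))
    (≃-trans (≃-rotate (suc i) (zero ∷ map suc w)) (≃-act (≡⇒≐ (cong (zero ∷_) (sym (map-++ suc w [ suc i ]))))))
  ≃-zero∷ (≃-trans p q)         = ≃-trans (≃-zero∷ p) (≃-zero∷ q)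

  -- Insert the square of s_(i+1) in front, rotate one copy to the end, and push the other to the
  -- right through all factors, conjugating each of them; the two copies then meet and cancel.
  conjugate-star : (i : Fin n) (a : Fin (suc n)) (us : List (Transposition n)) →
    star a ++ map suc (words us) ≃ star (swapF i a) ++ map suc (words (map (conjugate i) us))
  conjugate-star i a us = ≃-trans (≃-act (ext λ x → sym (swapF-involutive (suc i) _)))
    (≃-trans (≃-rotate i (suc i ∷ star a ++ U)) (≃-act simplify))
    where
    U  = map suc (words us)
    V  = words (map (conjugate i) us)
    a' = swapF i a
    simplify : (suc i ∷ star a ++ U) ++ [ suc i ] ≐ star a' ++ map suc V
    simplify =
      ≐-trans (++-≐ʳ [ suc i ] (≐-trans (++-≐ʳ U (map-suc-star [ i ] a)) (≡⇒≐ (++-assoc (star a') [ suc i ] U))))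
      (≐-trans (++-≐ʳ [ suc i ] (++-≐ˡ (star a') (map-suc-≐ (conjugate-words i us))))
      (≐-trans (≡⇒≐ (trans (cong (λ t → (star a' ++ t) ++ [ suc i ]) (map-++ suc V [ i ]))
        (trans (cong (_++ [ suc i ]) (sym (++-assoc (star a') _ _))) (++-assoc (star a' ++ map suc V) _ _))))
      (≐-trans (++-≐ˡ (star a' ++ map suc V) (ext (swapF-involutive (suc i)))) (≡⇒≐ (++-identityʳ _)))))

  -- The word s_0 s_1 ... s_(a-1). Its shift conjugates `star a` to `star zero`, which is a single
  -- letter.
  descent : Fin (suc n) → Word n
  descent         zero    = []
  descent {suc n} (suc a) = zero ∷ map suc (descent a)

  act-descent : (a : Fin (suc n)) → act (descent a) a ≡ zero
  act-descent         zero    = refl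
  act-descent {suc n} (suc a) = cong (swapF zero) (trans (act-map-suc (descent a) a) (cong suc (act-descent a)))

  conjugate-star* : (g : Word n) (a : Fin (suc n)) (us : List (Transposition n)) →
    ∃ λ vs → length vs ≡ length us × star a ++ map suc (words us) ≃ star (act g a) ++ map suc (words vs)
  conjugate-star* []      a us = us , refl , ≃-act (≡⇒≐ refl)
  conjugate-star* (i ∷ g) a us with conjugate-star* g a us
  ... | vs , l , p = map (conjugate i) vs , trans (length-map _ vs) l , ≃-trans p (conjugate-star i (act g a) vs)

  -- Each level of the recursion on `n` emits at most one letter, and emits it only at the cost of
  -- the transposition moving 0 that `gather` has left. Hence there are no more letters than
  -- transpositions, although the word of a single transposition may be long.
  shorten : (ts : List (Transposition n)) → ∃ λ v → words ts ≃ v × length v ≼ length ts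
  shorten {zero}  []       = [] , ≃-act (≡⇒≐ refl) , ≼-refl
  shorten {zero}  (swap0 () ∷ _)
  shorten {suc n} ts with gather ts
  ... | none us p l with shorten us
  ...   | v , q , l' = map suc v , ≃-trans (≃-act p) (≃-shift q) , subst (_≼ length ts) (sym (length-map suc v)) (≼-trans l' l)
  shorten {suc n} ts | one a us p l with conjugate-star* (descent a) a us
  ... | vs , e , q with shorten vs
  ...   | v , r , l' = zero ∷ map suc v ,
    ≃-trans (≃-act p) (≃-trans q (≃-trans (≃-act (≡⇒≐ (cong (λ b → star b ++ map suc (words vs)) (act-descent a)))) (≃-zero∷ r))) ,
    subst (λ m → suc m ≼ length ts) (sym (length-map suc v)) (≼-trans (≼-suc (subst (length v ≼_) e l')) l)

  -- Enumerating permutations and counting words by their product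

  prodW-act : (w : Word n) (x : Fin (suc n)) → lookup (prodW w) x ≡ act w x
  prodW-act []      x = lookup-allFin x
  prodW-act (i ∷ w) x = trans (lookup-map x (swapF i) (prodW w)) (cong (swapF i) (prodW-act w x))

  prodW⇒~ : (w v : Word n) → prodW w ≡ prodW v → w ~ v
  prodW⇒~ w v p = ≐⇒~ w v (ext λ x →
    trans (sym (prodW-act w x)) (trans (cong (λ σ → lookup σ x) p) (prodW-act v x)))

  toList-tabulate : ∀ {A : Set} {m} (f : Fin m → A) → toList (Vec.tabulate f) ≡ tabulate f
  toList-tabulate {m = zero}  f = refl
  toList-tabulate {m = suc m} f = cong (f zero ∷_) (toList-tabulate (λ x → f (suc x)))

  prodW-isPerm : (w : Word n) → IsPerm (prodW w)
  prodW-isPerm []      = subst Unique (sym (toList-tabulate (λ x → x))) (Unique.allFin⁺ _)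
  prodW-isPerm (i ∷ w) = subst Unique (sym (toList-map (swapF i) (prodW w)))
    (Unique.map⁺ (act-injective [ i ]) (prodW-isPerm w))

  concatMap-unique : ∀ {A B : Set} (g : A → List B) {xs} → Unique xs → (∀ x → Unique (g x)) →
    (∀ {x y z} → z ∈ g x → z ∈ g y → x ≡ y) → Unique (concatMap g xs)
  concatMap-unique g {xs} xs! g! separate = Unique.concat⁺ (All.map⁺ (All.universal g! xs))
    (AllPairs.map⁺ (AllPairs.map (λ x≢y {_} (p , q) → x≢y (separate p q)) xs!))

  allVecs-unique : ∀ {n} m → Unique (allVecs {n} m)
  allVecs-unique zero    = [] ∷ []
  allVecs-unique (suc m) = concatMap-unique _ (allVecs-unique m)
    (λ v → Unique.map⁺ ∷-injectiveˡ (Unique.allFin⁺ _))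
    (λ p q → let _ , _ , e = ∈-map⁻ _ p ; _ , _ , f = ∈-map⁻ _ q in ∷-injectiveʳ (trans (sym e) f))

  ∈-allVecs : ∀ {n m} (v : Vec (Fin n) m) → v ∈ allVecs m
  ∈-allVecs Vec.[]      = here refl
  ∈-allVecs (x Vec.∷ v) = ∈-concatMap⁺ (λ v → map (Vec._∷ v) (allFin _))
    (Any.map (λ { refl → ∈-map⁺ (Vec._∷ v) (∈-allFin x) }) (∈-allVecs v))

  -- Recording the rank together with the permutation turns the double sum over n and S_n into one
  -- sum over the duplicate-free list `keys k`.
  Key : Set
  Key = Σ ℕ λ n → Perm (suc n)

  _≟ᴷ_ : DecidableEquality Key
  _≟ᴷ_ = Σ.≡-dec ℕ._≟_ (Vec.≡-dec _≟_)

  keysAt : ℕ → List Key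
  keysAt n = map (n ,_) (allPerms (suc n))

  keys : ℕ → List Key
  keys k = concatMap keysAt (upTo (suc k))

  keys-unique : ∀ k → Unique (keys k)
  keys-unique k = concatMap-unique keysAt (Unique.upTo⁺ (suc k))
    (λ n → Unique.map⁺ {f = n ,_} (λ { refl → refl }) (Unique.filter⁺ (λ σ → UFin.unique? (toList σ)) (allVecs-unique (suc n))))
    (λ {x} {y} p q → let _ , _ , e = ∈-map⁻ (x ,_) p ; _ , _ , f = ∈-map⁻ (y ,_) q in cong proj₁ (trans (sym e) f))

  ∈-keys : ∀ {k n} (σ : Perm (suc n)) → n ≤ k → IsPerm σ → (n , σ) ∈ keys k
  ∈-keys {n = n} σ n≤k σ! = ∈-concatMap⁺ keysAt
    (Any.map (λ { refl → ∈-map⁺ (n ,_) (∈-filter⁺ (λ σ → UFin.unique? (toList σ)) (∈-allVecs σ) σ!) }) (∈-upTo⁺ (s≤s n≤k)))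

  map-keys : ∀ {a} {A : Set a} (F : Key → A) ns →
    map F (concatMap keysAt ns) ≡ concatMap (λ n → map (λ σ → F (n , σ)) (allPerms (suc n))) ns
  map-keys F ns = trans (map-concatMap F keysAt ns)
    (concatMap-cong (λ n → sym (map-∘ {g = F} {f = n ,_} (allPerms (suc n)))) ns)

  IndexedWord : Set
  IndexedWord = Σ ℕ Word

  key : IndexedWord → Key
  key (n , w) = n , prodW w

  indicator : Bool → ℕ
  indicator true  = 1
  indicator false = 0

  -- These become the coefficients of the theorem: they count the words with a given rank and
  -- product.
  multiplicity : List IndexedWord → Key → ℕ
  multiplicity []       κ = 0
  multiplicity (w ∷ ws) κ = indicator (does (key w ≟ᴷ κ)) + multiplicity ws κ

  multiplicity-∈ : ∀ ws κ → multiplicity ws κ ≢ 0 → ∃ λ w → w ∈ ws × key w ≡ κ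
  multiplicity-∈ []       κ m≢0 = contradiction refl m≢0
  multiplicity-∈ (w ∷ ws) κ m≢0 with key w ≟ᴷ κ
  ... | yes p = w , here refl , p
  ... | no  _ with multiplicity-∈ ws κ m≢0
  ...   | v , v∈ws , p = v , there v∈ws , p

  -- The terms in the expansion of a power of the dot

  widen : Transposition n → Transposition (suc n)
  widen (swap0 j) = swap0 (inject₁ j)
  widen (shift t) = shift (widen t)

  map-inject₁-suc : (w : Word n) → map inject₁ (map suc w) ≡ map suc (map inject₁ w)
  map-inject₁-suc w = trans (sym (map-∘ w)) (map-∘ w)

  star-inject₁ : (j : Fin n) → star (inject₁ j) ≡ map inject₁ (star j)
  star-inject₁ zero    = refl
  star-inject₁ (suc j) = cong (zero ∷_) (begin
    map suc (star (inject₁ j)) ++ [ zero ]      ≡⟨ cong (λ w → map suc w ++ [ zero ]) (star-inject₁ j) ⟩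
    map suc (map inject₁ (star j)) ++ [ zero ]  ≡⟨ cong (_++ [ zero ]) (map-inject₁-suc (star j)) ⟨
    map inject₁ (map suc (star j)) ++ [ zero ]  ≡⟨ map-++ inject₁ (map suc (star j)) [ zero ] ⟨
    map inject₁ (map suc (star j) ++ [ zero ])  ∎)

  word-widen : (t : Transposition n) → word (widen t) ≡ map inject₁ (word t)
  word-widen (swap0 j) = star-inject₁ j
  word-widen (shift t) = trans (cong (map suc) (word-widen t)) (sym (map-inject₁-suc (word t)))

  words-widen : (ts : List (Transposition n)) → words (map widen ts) ≡ map inject₁ (words ts)
  words-widen []       = refl
  words-widen (t ∷ ts) = trans (cong₂ _++_ (word-widen t) (words-widen ts)) (sym (map-++ inject₁ (word t) (words ts)))

  -- The first component counts the closed strands only, so it is one less than the total number of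
  -- strands.
  Term : Set
  Term = Σ ℕ λ n → List (Transposition n)

  -- Multiplication by one dot. The head opens a new closed strand, placed last by `widen` (not
  -- first, as `shift` would), and exchanges it with the open one; the tail has one term for each
  -- closed strand already present.
  step : Term → List Term
  step (n , ts) = (suc n , swap0 (fromℕ n) ∷ map widen ts) ∷ tabulate (λ j → n , swap0 j ∷ ts)

  terms : ℕ → List Term
  terms zero    = [ (0 , []) ]
  terms (suc k) = concatMap step (terms k)

  terms-bounded : ∀ k → All (λ (n , ts) → n ≤ k × length ts ≡ k) (terms k)
  terms-bounded zero    = (z≤n , refl) ∷ []
  terms-bounded (suc k) = All.concat⁺ (All.map⁺ (All.map
    (λ { {_ , ts} (n≤k , l) → (s≤s n≤k , cong suc (trans (length-map widen ts) l))
                            ∷ All.tabulate⁺ (λ j → m≤n⇒m≤1+n n≤k , cong suc l) })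
    (terms-bounded k)))

  shortWord : Term → IndexedWord
  shortWord (n , ts) = n , proj₁ (shorten ts)

  shortWords : ℕ → List IndexedWord
  shortWords k = map shortWord (terms k)

  shortWords-bounded : ∀ k → All (λ (n , w) → n ≤ k × length w ≼ k) (shortWords k)
  shortWords-bounded k = All.map⁺ (All.map
    (λ { {_ , ts} (n≤k , refl) → n≤k , proj₂ (proj₂ (shorten ts)) }) (terms-bounded k))

open Permutations

module Diagrams {c ℓ} (R : CommutativeRing c ℓ) where
  open Heis R

  -- Equational reasoning and whiskering in the monoidal category

  infix  1 begin_
  infixr 2 _≈⟨_⟩_ _≈⟨_⟨_ _≡⟨_⟩_ _≡⟨_⟨_
  infix  3 _∎

  begin_ : ∀ {a b} {f g : Mor a b} → f ≈ g → f ≈ g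
  begin p = p

  _≈⟨_⟩_ : ∀ {a b} (f : Mor a b) {g h : Mor a b} → f ≈ g → g ≈ h → f ≈ h
  f ≈⟨ p ⟩ q = ≈-trans p q

  _≈⟨_⟨_ : ∀ {a b} (f : Mor a b) {g h : Mor a b} → g ≈ f → g ≈ h → f ≈ h
  f ≈⟨ p ⟨ q = ≈-trans (≈-sym p) q

  _≡⟨_⟩_ : ∀ {a b} (f : Mor a b) {g h : Mor a b} → f ≡ g → g ≈ h → f ≈ h
  f ≡⟨ refl ⟩ q = q

  _≡⟨_⟨_ : ∀ {a b} (f : Mor a b) {g h : Mor a b} → g ≡ f → g ≈ h → f ≈ h
  f ≡⟨ refl ⟨ q = q

  _∎ : ∀ {a b} (f : Mor a b) → f ≈ f
  f ∎ = ≈-refl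

  infixr 8 _◁_
  infixl 8 _▷_

  _◁_ : ∀ (a : Obj) {b d} → Mor b d → Mor (a ++ b) (a ++ d)
  a ◁ f = idm a ⊗ f

  _▷_ : ∀ {a b} → Mor a b → (d : Obj) → Mor (a ++ d) (b ++ d)
  f ▷ d = f ⊗ idm d

  ∘-congˡ : ∀ {a b d} {f : Mor b d} {g g' : Mor a b} → g ≈ g' → f ∘ g ≈ f ∘ g'
  ∘-congˡ = ∘-cong ≈-refl

  ∘-congʳ : ∀ {a b d} {f f' : Mor b d} {g : Mor a b} → f ≈ f' → f ∘ g ≈ f' ∘ g
  ∘-congʳ p = ∘-cong p ≈-refl

  ◁-cong : ∀ a {b d} {f g : Mor b d} → f ≈ g → a ◁ f ≈ a ◁ g
  ◁-cong a = ⊗-cong ≈-refl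

  ▷-cong : ∀ {a b} {f g : Mor a b} d → f ≈ g → f ▷ d ≈ g ▷ d
  ▷-cong d p = ⊗-cong p ≈-refl

  ◁-∘ : ∀ a {b d e} (f : Mor d e) (g : Mor b d) → a ◁ (f ∘ g) ≈ a ◁ f ∘ a ◁ g
  ◁-∘ a f g = ≈-sym (≈-trans (interchange _ _ _ _) (⊗-cong (∘-idˡ _) ≈-refl))

  ▷-∘ : ∀ {a b d} (f : Mor b d) (g : Mor a b) e → (f ∘ g) ▷ e ≈ f ▷ e ∘ g ▷ e
  ▷-∘ f g e = ≈-sym (≈-trans (interchange _ _ _ _) (⊗-cong ≈-refl (∘-idˡ _)))

  ◁-∘₃ : ∀ a {b d e h} (f : Mor e h) (g : Mor d e) (k : Mor b d) →
         a ◁ (f ∘ g ∘ k) ≈ a ◁ f ∘ a ◁ g ∘ a ◁ k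
  ◁-∘₃ a f g k = ≈-trans (◁-∘ a f (g ∘ k)) (∘-congˡ (◁-∘ a g k))

  ▷-∘₃ : ∀ {b d e h} (f : Mor e h) (g : Mor d e) (k : Mor b d) a →
         (f ∘ g ∘ k) ▷ a ≈ f ▷ a ∘ g ▷ a ∘ k ▷ a
  ▷-∘₃ f g k a = ≈-trans (▷-∘ f (g ∘ k) a) (∘-congˡ (▷-∘ g k a))

  slide : ∀ {a b a' b'} (f : Mor a b) (g : Mor a' b') → f ▷ b' ∘ a ◁ g ≈ b ◁ g ∘ f ▷ a'
  slide f g = begin
    f ▷ _ ∘ _ ◁ g            ≈⟨ interchange _ _ _ _ ⟩
    (f ∘ idm _) ⊗ (idm _ ∘ g) ≈⟨ ⊗-cong (≈-trans (∘-idʳ f) (≈-sym (∘-idˡ f))) (≈-trans (∘-idˡ g) (≈-sym (∘-idʳ g))) ⟩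
    (idm _ ∘ f) ⊗ (g ∘ idm _) ≈⟨ interchange _ _ _ _ ⟨
    _ ◁ g ∘ f ▷ _            ∎

  pull : ∀ {a b d e} {f : Mor d e} {g : Mor b d} {h : Mor b e} {k : Mor a b} →
         f ∘ g ≈ h → f ∘ g ∘ k ≈ h ∘ k
  pull p = ≈-trans (≈-sym (∘-assoc _ _ _)) (∘-congʳ p)

  swapᵖ : ∀ {a b d d' e} {f : Mor d e} {g : Mor b d} {f' : Mor d' e} {g' : Mor b d'} {k : Mor a b} →
         f ∘ g ≈ f' ∘ g' → f ∘ g ∘ k ≈ f' ∘ g' ∘ k
  swapᵖ p = ≈-trans (pull p) (∘-assoc _ _ _)

  cancelˡ : ∀ {a b d} {f : Mor d b} {g : Mor b d} {k : Mor a b} →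
         f ∘ g ≈ idm b → f ∘ g ∘ k ≈ k
  cancelˡ p = ≈-trans (pull p) (∘-idˡ _)

  -- Sideways crossings and the degenerate affine Hecke relation

  u d ud du uu dd : Obj
  u = ↑ ∷ []
  d = ↓ ∷ []
  ud = ↑ ∷ ↓ ∷ []
  du = ↓ ∷ ↑ ∷ []
  uu = ↑ ∷ ↑ ∷ []
  dd = ↓ ∷ ↓ ∷ []

  -- For an explicit word on the left `++-assoc` computes to `refl`, so the `castM` in `⊗-assoc`
  -- disappears. This is why strands are added on the left one letter at a time.
  ◁◁ : ∀ s t {b e} (f : Mor b e) → (s ∷ []) ◁ ((t ∷ []) ◁ f) ≈ (s ∷ t ∷ []) ◁ f
  ◁◁ s t f = ≈-trans (≈-sym (⊗-assoc _ _ f)) (⊗-cong (⊗-idm _ _) ≈-refl)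

  ▷▷ : ∀ s {b e} (f : Mor b e) z → ((s ∷ []) ◁ f) ▷ z ≈ (s ∷ []) ◁ (f ▷ z)
  ▷▷ s f z = ⊗-assoc (idm (s ∷ [])) f (idm z)

  -- `Y₋₊` is `X` bent by a cup and a cap. Its crossing and its cup slide past the given cup, after
  -- which the given cup and the cap of `Y₋₊` straighten by `zigzag₁`. Together with `cap-swing` it
  -- turns upward crossings at a curl into the sideways ones to which `rel4` applies.
  cup-swing : X ▷ d ∘ u ◁ cup↑↓ ≈ u ◁ Y₋₊ ∘ cup↑↓ ▷ u
  cup-swing = ≈-sym (begin
    u ◁ Y₋₊ ∘ cup↑↓ ▷ u
      ≈⟨ ∘-congʳ (◁-∘₃ u _ _ _) ⟩
    (u ◁ (cap↓↑ ▷ ud) ∘ u ◁ (d ◁ (X ▷ d)) ∘ u ◁ (du ◁ cup↑↓)) ∘ cup↑↓ ▷ u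
      ≈⟨ ≈-trans (∘-assoc _ _ _) (∘-congˡ (∘-assoc _ _ _)) ⟩
    u ◁ (cap↓↑ ▷ ud) ∘ u ◁ (d ◁ (X ▷ d)) ∘ u ◁ (du ◁ cup↑↓) ∘ cup↑↓ ▷ u
      ≈⟨ ∘-congˡ (∘-cong (◁◁ ↑ ↓ _) (∘-congʳ (≈-trans (◁-cong u (≈-sym (◁◁ ↓ ↑ cup↑↓))) (◁◁ ↑ ↓ _)))) ⟩
    u ◁ (cap↓↑ ▷ ud) ∘ ud ◁ (X ▷ d) ∘ ud ◁ (u ◁ cup↑↓) ∘ cup↑↓ ▷ u
      ≈⟨ ∘-congˡ (∘-congˡ (≈-trans (≈-sym (slide cup↑↓ (u ◁ cup↑↓))) (∘-congˡ (⊗-idˡ _)))) ⟩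
    u ◁ (cap↓↑ ▷ ud) ∘ ud ◁ (X ▷ d) ∘ cup↑↓ ▷ (↑ ∷ ud) ∘ u ◁ cup↑↓
      ≈⟨ ∘-congˡ (swapᵖ (≈-trans (≈-sym (slide cup↑↓ (X ▷ d))) (∘-congˡ (⊗-idˡ _)))) ⟩
    u ◁ (cap↓↑ ▷ ud) ∘ cup↑↓ ▷ (↑ ∷ ud) ∘ X ▷ d ∘ u ◁ cup↑↓
      ≈⟨ cancelˡ straighten ⟩
    X ▷ d ∘ u ◁ cup↑↓ ∎)
    where
    straighten : u ◁ (cap↓↑ ▷ ud) ∘ cup↑↓ ▷ (↑ ∷ ud) ≈ idm (↑ ∷ ud)
    straighten = begin
      u ◁ (cap↓↑ ▷ ud) ∘ cup↑↓ ▷ (↑ ∷ ud)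
        ≈⟨ ∘-cong (≈-sym (▷▷ ↑ cap↓↑ ud)) (≈-trans (⊗-cong ≈-refl (≈-sym (⊗-idm u ud))) (≈-sym (⊗-assoc cup↑↓ id↑ (idm ud)))) ⟩
      (u ◁ cap↓↑) ▷ ud ∘ (cup↑↓ ▷ u) ▷ ud
        ≈⟨ ▷-∘ _ _ ud ⟨
      (u ◁ cap↓↑ ∘ cup↑↓ ▷ u) ▷ ud
        ≈⟨ ▷-cong ud zigzag₁ ⟩
      u ◁ idm ud
        ≈⟨ ⊗-idm u ud ⟩
      idm (↑ ∷ ud) ∎

  cap-swing : u ◁ cap↑↓ ∘ X ▷ d ≈ cap↑↓ ▷ u ∘ u ◁ Y₊₋
  cap-swing = ≈-sym (begin
    cap↑↓ ▷ u ∘ u ◁ Y₊₋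
      ≈⟨ ∘-congˡ (◁-∘₃ u _ _ _) ⟩
    cap↑↓ ▷ u ∘ u ◁ (d ◁ (u ◁ cap↑↓)) ∘ u ◁ (d ◁ (X ▷ d)) ∘ u ◁ (cup↓↑ ▷ ud)
      ≈⟨ ∘-congˡ (∘-cong (◁◁ ↑ ↓ _) (∘-congʳ (◁◁ ↑ ↓ _))) ⟩
    cap↑↓ ▷ u ∘ ud ◁ (u ◁ cap↑↓) ∘ ud ◁ (X ▷ d) ∘ u ◁ (cup↓↑ ▷ ud)
      ≈⟨ swapᵖ (≈-trans (slide cap↑↓ (u ◁ cap↑↓)) (∘-congʳ (⊗-idˡ _))) ⟩
    u ◁ cap↑↓ ∘ cap↑↓ ▷ (↑ ∷ ud) ∘ ud ◁ (X ▷ d) ∘ u ◁ (cup↓↑ ▷ ud)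
      ≈⟨ ∘-congˡ (swapᵖ (≈-trans (slide cap↑↓ (X ▷ d)) (∘-congʳ (⊗-idˡ _)))) ⟩
    u ◁ cap↑↓ ∘ X ▷ d ∘ cap↑↓ ▷ (↑ ∷ ud) ∘ u ◁ (cup↓↑ ▷ ud)
      ≈⟨ ∘-congˡ (≈-trans (∘-congˡ straighten) (∘-idʳ _)) ⟩
    u ◁ cap↑↓ ∘ X ▷ d ∎)
    where
    straighten : cap↑↓ ▷ (↑ ∷ ud) ∘ u ◁ (cup↓↑ ▷ ud) ≈ idm (↑ ∷ ud)
    straighten = begin
      cap↑↓ ▷ (↑ ∷ ud) ∘ u ◁ (cup↓↑ ▷ ud)
        ≈⟨ ∘-cong (≈-trans (⊗-cong ≈-refl (≈-sym (⊗-idm u ud))) (≈-sym (⊗-assoc cap↑↓ id↑ (idm ud)))) (≈-sym (▷▷ ↑ cup↓↑ ud)) ⟩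
      (cap↑↓ ▷ u) ▷ ud ∘ (u ◁ cup↓↑) ▷ ud
        ≈⟨ ▷-∘ _ _ ud ⟨
      (cap↑↓ ▷ u ∘ u ◁ cup↓↑) ▷ ud
        ≈⟨ ▷-cong ud zigzag₃ ⟩
      u ◁ idm ud
        ≈⟨ ⊗-idm u ud ⟩
      idm (↑ ∷ ud) ∎

  +-congˡ : ∀ {a b} {f g g' : Mor a b} → g ≈ g' → f +ₘ g ≈ f +ₘ g'
  +-congˡ = +-cong ≈-refl

  +-congʳ : ∀ {a b} {f f' g : Mor a b} → f ≈ f' → f +ₘ g ≈ f' +ₘ g
  +-congʳ p = +-cong p ≈-refl

  +-idʳ : ∀ {a b} (f : Mor a b) → f +ₘ zer ≈ f
  +-idʳ f = ≈-trans (+-comm f zer) (+-idˡ f)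

  zigzag-uu₁ : u ◁ (u ◁ cap↓↑) ∘ u ◁ (cup↑↓ ▷ u) ≈ idm uu
  zigzag-uu₁ = ≈-trans (≈-sym (◁-∘ u _ _)) (≈-trans (◁-cong u zigzag₁) (⊗-idm u u))

  zigzag-uu₃ : u ◁ (cap↑↓ ▷ u) ∘ u ◁ (u ◁ cup↓↑) ≈ idm uu
  zigzag-uu₃ = ≈-trans (≈-sym (◁-∘ u _ _)) (≈-trans (◁-cong u zigzag₃) (⊗-idm u u))

  X-slide : ∀ {a b} (g : Mor a b) → X ▷ b ∘ u ◁ (u ◁ g) ≈ u ◁ (u ◁ g) ∘ X ▷ a
  X-slide g = begin
    X ▷ _ ∘ u ◁ (u ◁ g) ≈⟨ ∘-congˡ (◁◁ ↑ ↑ g) ⟩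
    X ▷ _ ∘ uu ◁ g      ≈⟨ slide X g ⟩
    uu ◁ g ∘ X ▷ _      ≈⟨ ∘-congʳ (◁◁ ↑ ↑ g) ⟨
    u ◁ (u ◁ g) ∘ X ▷ _ ∎

  braid : ∀ z → X ▷ (↑ ∷ z) ∘ u ◁ (X ▷ z) ∘ X ▷ (↑ ∷ z)
              ≈ u ◁ (X ▷ z) ∘ X ▷ (↑ ∷ z) ∘ u ◁ (X ▷ z)
  braid z = begin
    X ▷ (↑ ∷ z) ∘ u ◁ (X ▷ z) ∘ X ▷ (↑ ∷ z)      ≈⟨ ∘-cong X▷▷ (∘-cong (▷▷ ↑ X z) X▷▷) ⟨
    (X ▷ u) ▷ z ∘ (u ◁ X) ▷ z ∘ (X ▷ u) ▷ z      ≈⟨ ▷-∘₃ _ _ _ z ⟨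
    (X ▷ u ∘ u ◁ X ∘ X ▷ u) ▷ z                  ≈⟨ ▷-cong z rel2 ⟩
    (u ◁ X ∘ X ▷ u ∘ u ◁ X) ▷ z                  ≈⟨ ▷-∘₃ _ _ _ z ⟩
    (u ◁ X) ▷ z ∘ (X ▷ u) ▷ z ∘ (u ◁ X) ▷ z      ≈⟨ ∘-cong (▷▷ ↑ X z) (∘-cong X▷▷ (▷▷ ↑ X z)) ⟩
    u ◁ (X ▷ z) ∘ X ▷ (↑ ∷ z) ∘ u ◁ (X ▷ z)      ∎
    where
    X▷▷ : (X ▷ u) ▷ z ≈ X ▷ (↑ ∷ z)
    X▷▷ = ≈-trans (⊗-assoc X id↑ (idm z)) (⊗-cong ≈-refl (⊗-idm u z))

  X▷[] : X ▷ [] ≈ X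
  X▷[] = ⊗-idʳ X

  -- The outer crossings slide inside the curl, where the three crossings form one side of the braid
  -- relation. On its other side the outer two touch the cap and the cup, and swing into sideways
  -- crossings; these commute with the middle crossing and so become adjacent.
  twisted-dot : X ∘ u ◁ dot ∘ X ≈
    u ◁ (cap↑↓ ▷ u) ∘ (X ▷ du ∘ u ◁ (u ◁ (Y₊₋ ∘ Y₋₊))) ∘ u ◁ (cup↑↓ ▷ u)
  twisted-dot = begin
    X ∘ u ◁ dot ∘ X
      ≈⟨ ∘-congˡ (≈-trans (∘-congʳ (◁-∘₃ u _ _ _)) (≈-trans (∘-assoc _ _ _) (∘-congˡ (∘-assoc _ _ _)))) ⟩
    X ∘ u ◁ (u ◁ cap↑↓) ∘ u ◁ (X ▷ d) ∘ u ◁ (u ◁ cup↑↓) ∘ X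
      ≈⟨ swapᵖ (≈-trans (∘-congʳ (≈-sym X▷[])) (X-slide cap↑↓)) ⟩
    u ◁ (u ◁ cap↑↓) ∘ X ▷ ud ∘ u ◁ (X ▷ d) ∘ u ◁ (u ◁ cup↑↓) ∘ X
      ≈⟨ ∘-congˡ (∘-congˡ (∘-congˡ (≈-trans (∘-congˡ (≈-sym X▷[])) (≈-sym (X-slide cup↑↓))))) ⟩
    u ◁ (u ◁ cap↑↓) ∘ X ▷ ud ∘ u ◁ (X ▷ d) ∘ X ▷ ud ∘ u ◁ (u ◁ cup↑↓)
      ≈⟨ ∘-congˡ (≈-trans (≈-trans (∘-congˡ (≈-sym (∘-assoc _ _ _))) (pull (braid d))) (≈-trans (∘-assoc _ _ _) (∘-congˡ (∘-assoc _ _ _)))) ⟩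
    u ◁ (u ◁ cap↑↓) ∘ u ◁ (X ▷ d) ∘ X ▷ ud ∘ u ◁ (X ▷ d) ∘ u ◁ (u ◁ cup↑↓)
      ≈⟨ swapᵖ (≈-trans (≈-sym (◁-∘ u _ _)) (≈-trans (◁-cong u cap-swing) (◁-∘ u _ _))) ⟩
    u ◁ (cap↑↓ ▷ u) ∘ u ◁ (u ◁ Y₊₋) ∘ X ▷ ud ∘ u ◁ (X ▷ d) ∘ u ◁ (u ◁ cup↑↓)
      ≈⟨ ∘-congˡ (∘-congˡ (∘-congˡ (≈-trans (≈-sym (◁-∘ u _ _)) (≈-trans (◁-cong u cup-swing) (◁-∘ u _ _))))) ⟩
    u ◁ (cap↑↓ ▷ u) ∘ u ◁ (u ◁ Y₊₋) ∘ X ▷ ud ∘ u ◁ (u ◁ Y₋₊) ∘ u ◁ (cup↑↓ ▷ u)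
      ≈⟨ ∘-congˡ (swapᵖ (≈-sym (X-slide Y₊₋))) ⟩
    u ◁ (cap↑↓ ▷ u) ∘ X ▷ du ∘ u ◁ (u ◁ Y₊₋) ∘ u ◁ (u ◁ Y₋₊) ∘ u ◁ (cup↑↓ ▷ u)
      ≈⟨ ∘-congˡ (∘-congˡ (pull (≈-trans (≈-sym (◁-∘ u _ _)) (◁-cong u (≈-sym (◁-∘ u _ _)))))) ⟩
    u ◁ (cap↑↓ ▷ u) ∘ X ▷ du ∘ u ◁ (u ◁ (Y₊₋ ∘ Y₋₊)) ∘ u ◁ (cup↑↓ ▷ u)
      ≈⟨ ∘-congˡ (∘-assoc _ _ _) ⟨
    u ◁ (cap↑↓ ▷ u) ∘ (X ▷ du ∘ u ◁ (u ◁ (Y₊₋ ∘ Y₋₊))) ∘ u ◁ (cup↑↓ ▷ u) ∎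

  open CommutativeRing R using () renaming (1# to 1ᴿ; -_ to -ᴿ_)

  -- The degenerate affine Hecke relation.  Pulling the curl off the second strand across the first is
  -- rel2 followed by rel4, whose correction term straightens to a single crossing.
  hecke : dot ▷ u ≈ X ∘ u ◁ dot ∘ X +ₘ X
  hecke = begin
    dot ▷ u
      ≈⟨ +-idʳ _ ⟨
    dot ▷ u +ₘ zer
      -- `rel4` carries the coefficient -1, so the term `(-ᴿ 1ᴿ) · X` that it will produce is
      -- inserted here along with `X`.
      ≈⟨ +-congˡ (+-invˡ X) ⟨
    dot ▷ u +ₘ ((-ᴿ 1ᴿ) · X +ₘ X)
      ≈⟨ +-assoc _ _ _ ⟨
    (dot ▷ u +ₘ (-ᴿ 1ᴿ) · X) +ₘ X
      ≈⟨ +-congʳ (≈-sym (≈-trans twisted-dot (≈-trans (∘-congˡ (∘-congʳ (∘-congˡ expand))) distribute))) ⟩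
    X ∘ u ◁ dot ∘ X +ₘ X ∎
    where
    A : Mor (↑ ∷ ↑ ∷ ↓ ∷ ↑ ∷ []) uu
    A = u ◁ (cap↑↓ ▷ u)

    B : Mor uu (↑ ∷ ↑ ∷ ↓ ∷ ↑ ∷ [])
    B = u ◁ (cup↑↓ ▷ u)

    turnback : Mor du du
    turnback = cup↓↑ ∘ cap↓↑

    expand : u ◁ (u ◁ (Y₊₋ ∘ Y₋₊)) ≈ idm (↑ ∷ ↑ ∷ du) +ₘ (-ᴿ 1ᴿ) · (u ◁ (u ◁ turnback))
    expand = begin
      u ◁ (u ◁ (Y₊₋ ∘ Y₋₊))
        ≈⟨ ◁-cong u (◁-cong u rel4) ⟩
      u ◁ (u ◁ (idm du +ₘ (-ᴿ 1ᴿ) · turnback))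
        ≈⟨ ◁-cong u (≈-trans (⊗-distˡ _ _ _) (+-cong (⊗-idm u du) (⊗-·ʳ _ _ _))) ⟩
      u ◁ (idm (↑ ∷ du) +ₘ (-ᴿ 1ᴿ) · (u ◁ turnback))
        ≈⟨ ≈-trans (⊗-distˡ _ _ _) (+-cong (⊗-idm u (↑ ∷ du)) (⊗-·ʳ _ _ _)) ⟩
      idm (↑ ∷ ↑ ∷ du) +ₘ (-ᴿ 1ᴿ) · (u ◁ (u ◁ turnback)) ∎

    loop : A ∘ X ▷ du ∘ B ≈ dot ▷ u
    loop = begin
      A ∘ X ▷ du ∘ B
        ≈⟨ ∘-cong (▷▷ ↑ cap↑↓ u) (∘-cong (≈-trans (⊗-assoc X id↓ id↑) (⊗-cong ≈-refl (⊗-idm d u))) (▷▷ ↑ cup↑↓ u)) ⟨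
      (u ◁ cap↑↓) ▷ u ∘ (X ▷ d) ▷ u ∘ (u ◁ cup↑↓) ▷ u
        ≈⟨ ▷-∘₃ _ _ _ u ⟨
      dot ▷ u ∎

    crossing : A ∘ (X ▷ du ∘ u ◁ (u ◁ turnback)) ∘ B ≈ X
    crossing = begin
      A ∘ (X ▷ du ∘ u ◁ (u ◁ turnback)) ∘ B
        ≈⟨ ∘-congˡ (∘-congʳ (∘-congˡ (≈-trans (◁-cong u (◁-∘ u _ _)) (◁-∘ u _ _)))) ⟩
      A ∘ (X ▷ du ∘ u ◁ (u ◁ cup↓↑) ∘ u ◁ (u ◁ cap↓↑)) ∘ B
        ≈⟨ ∘-congˡ (≈-trans (∘-assoc _ _ _) (∘-congˡ (∘-assoc _ _ _))) ⟩
      A ∘ X ▷ du ∘ u ◁ (u ◁ cup↓↑) ∘ u ◁ (u ◁ cap↓↑) ∘ B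
        ≈⟨ ∘-congˡ (swapᵖ (≈-trans (X-slide cup↓↑) (∘-congˡ X▷[]))) ⟩
      A ∘ u ◁ (u ◁ cup↓↑) ∘ X ∘ u ◁ (u ◁ cap↓↑) ∘ B
        ≈⟨ cancelˡ zigzag-uu₃ ⟩
      X ∘ u ◁ (u ◁ cap↓↑) ∘ B
        ≈⟨ ≈-trans (∘-congˡ zigzag-uu₁) (∘-idʳ X) ⟩
      X ∎

    distribute : A ∘ (X ▷ du ∘ (idm (↑ ∷ ↑ ∷ du) +ₘ (-ᴿ 1ᴿ) · (u ◁ (u ◁ turnback)))) ∘ B
               ≈ dot ▷ u +ₘ (-ᴿ 1ᴿ) · X
    distribute = begin
      A ∘ (X ▷ du ∘ (idm (↑ ∷ ↑ ∷ du) +ₘ (-ᴿ 1ᴿ) · (u ◁ (u ◁ turnback)))) ∘ B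
        ≈⟨ ∘-congˡ (∘-congʳ (≈-trans (∘-distˡ _ _ _) (+-cong (∘-idʳ _) (∘-·ʳ _ _ _)))) ⟩
      A ∘ (X ▷ du +ₘ (-ᴿ 1ᴿ) · (X ▷ du ∘ u ◁ (u ◁ turnback))) ∘ B
        ≈⟨ ∘-congˡ (≈-trans (∘-distʳ _ _ _) (+-congˡ (∘-·ˡ _ _ _))) ⟩
      A ∘ (X ▷ du ∘ B +ₘ (-ᴿ 1ᴿ) · ((X ▷ du ∘ u ◁ (u ◁ turnback)) ∘ B))
        ≈⟨ ≈-trans (∘-distˡ _ _ _) (+-congˡ (∘-·ʳ _ _ _)) ⟩
      A ∘ X ▷ du ∘ B +ₘ (-ᴿ 1ᴿ) · (A ∘ (X ▷ du ∘ u ◁ (u ◁ turnback)) ∘ B)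
        ≈⟨ +-cong loop (·-cong (CommutativeRing.refl R) crossing) ⟩
      dot ▷ u +ₘ (-ᴿ 1ᴿ) · X ∎

  -- Rotating a crossing around nested cups and caps

  zigzag-nested₁ : uu ◁ capN ∘ cupN ▷ uu ≈ idm uu
  zigzag-nested₁ = begin
    uu ◁ capN ∘ cupN ▷ uu
      ≈⟨ ∘-cong (◁-∘ uu _ _) (▷-∘ _ _ uu) ⟩
    (uu ◁ cap↓↑ ∘ uu ◁ (d ◁ (cap↓↑ ▷ u))) ∘ (u ◁ (cup↑↓ ▷ d)) ▷ uu ∘ cup↑↓ ▷ uu
      ≈⟨ ∘-assoc _ _ _ ⟩
    uu ◁ cap↓↑ ∘ uu ◁ (d ◁ (cap↓↑ ▷ u)) ∘ (u ◁ (cup↑↓ ▷ d)) ▷ uu ∘ cup↑↓ ▷ uu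
      ≈⟨ ∘-congˡ (swapᵖ middle) ⟩
    uu ◁ cap↓↑ ∘ u ◁ (cup↑↓ ▷ u) ∘ u ◁ (cap↓↑ ▷ u) ∘ cup↑↓ ▷ uu
      ≈⟨ cancelˡ (≈-trans (∘-congʳ (≈-sym (◁◁ ↑ ↑ cap↓↑))) zigzag-uu₁) ⟩
    u ◁ (cap↓↑ ▷ u) ∘ cup↑↓ ▷ uu
      ≈⟨ ∘-cong (▷▷ ↑ cap↓↑ u) (≈-trans (⊗-assoc cup↑↓ id↑ id↑) (⊗-cong ≈-refl (⊗-idm u u))) ⟨
    (u ◁ cap↓↑) ▷ u ∘ (cup↑↓ ▷ u) ▷ u
      ≈⟨ ≈-trans (≈-sym (▷-∘ _ _ u)) (≈-trans (▷-cong u zigzag₁) (⊗-idm u u)) ⟩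
    idm uu ∎
    where
    middle : uu ◁ (d ◁ (cap↓↑ ▷ u)) ∘ (u ◁ (cup↑↓ ▷ d)) ▷ uu ≈ u ◁ (cup↑↓ ▷ u) ∘ u ◁ (cap↓↑ ▷ u)
    middle = begin
      uu ◁ (d ◁ (cap↓↑ ▷ u)) ∘ (u ◁ (cup↑↓ ▷ d)) ▷ uu
        ≈⟨ ∘-cong (≈-trans (≈-sym (◁◁ ↑ ↑ _)) (◁-cong u (◁◁ ↑ ↓ _)))
                  (≈-trans (▷▷ ↑ _ uu) (◁-cong u (≈-trans (⊗-assoc cup↑↓ id↓ (idm uu)) (⊗-cong ≈-refl (⊗-idm d uu))))) ⟩
      u ◁ (ud ◁ (cap↓↑ ▷ u)) ∘ u ◁ (cup↑↓ ▷ (↓ ∷ uu))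
        ≈⟨ ◁-∘ u _ _ ⟨
      u ◁ (ud ◁ (cap↓↑ ▷ u) ∘ cup↑↓ ▷ (↓ ∷ uu))
        ≈⟨ ◁-cong u (≈-trans (≈-sym (slide cup↑↓ (cap↓↑ ▷ u))) (∘-congˡ (⊗-idˡ _))) ⟩
      u ◁ (cup↑↓ ▷ u ∘ cap↓↑ ▷ u)
        ≈⟨ ◁-∘ u _ _ ⟩
      u ◁ (cup↑↓ ▷ u) ∘ u ◁ (cap↓↑ ▷ u) ∎

  zigzag-nested₃ : capN' ▷ uu ∘ uu ◁ cupN' ≈ idm uu
  zigzag-nested₃ = begin
    capN' ▷ uu ∘ uu ◁ cupN'
      ≈⟨ ∘-cong (▷-∘ _ _ uu) (◁-∘ uu _ _) ⟩
    (cap↑↓ ▷ uu ∘ (u ◁ (cap↑↓ ▷ d)) ▷ uu) ∘ uu ◁ (d ◁ (cup↓↑ ▷ u)) ∘ uu ◁ cup↓↑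
      ≈⟨ ∘-assoc _ _ _ ⟩
    cap↑↓ ▷ uu ∘ (u ◁ (cap↑↓ ▷ d)) ▷ uu ∘ uu ◁ (d ◁ (cup↓↑ ▷ u)) ∘ uu ◁ cup↓↑
      ≈⟨ ∘-congˡ (swapᵖ middle) ⟩
    cap↑↓ ▷ uu ∘ u ◁ (cup↓↑ ▷ u) ∘ u ◁ (cap↑↓ ▷ u) ∘ uu ◁ cup↓↑
      ≈⟨ cancelˡ (≈-trans (∘-cong (≈-sym (≈-trans (⊗-assoc cap↑↓ id↑ id↑) (⊗-cong ≈-refl (⊗-idm u u)))) (≈-sym (▷▷ ↑ cup↓↑ u)))
                   (≈-trans (≈-sym (▷-∘ _ _ u)) (≈-trans (▷-cong u zigzag₃) (⊗-idm u u)))) ⟩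
    u ◁ (cap↑↓ ▷ u) ∘ uu ◁ cup↓↑
      ≈⟨ ≈-trans (∘-congˡ (≈-sym (◁◁ ↑ ↑ cup↓↑))) zigzag-uu₃ ⟩
    idm uu ∎
    where
    middle : (u ◁ (cap↑↓ ▷ d)) ▷ uu ∘ uu ◁ (d ◁ (cup↓↑ ▷ u)) ≈ u ◁ (cup↓↑ ▷ u) ∘ u ◁ (cap↑↓ ▷ u)
    middle = begin
      (u ◁ (cap↑↓ ▷ d)) ▷ uu ∘ uu ◁ (d ◁ (cup↓↑ ▷ u))
        ≈⟨ ∘-cong (≈-trans (▷▷ ↑ _ uu) (◁-cong u (≈-trans (⊗-assoc cap↑↓ id↓ (idm uu)) (⊗-cong ≈-refl (⊗-idm d uu)))))
                  (≈-trans (≈-sym (◁◁ ↑ ↑ _)) (◁-cong u (◁◁ ↑ ↓ _))) ⟩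
      u ◁ (cap↑↓ ▷ (↓ ∷ uu)) ∘ u ◁ (ud ◁ (cup↓↑ ▷ u))
        ≈⟨ ◁-∘ u _ _ ⟨
      u ◁ (cap↑↓ ▷ (↓ ∷ uu) ∘ ud ◁ (cup↓↑ ▷ u))
        ≈⟨ ◁-cong u (≈-trans (slide cap↑↓ (cup↓↑ ▷ u)) (∘-congʳ (⊗-idˡ _))) ⟩
      u ◁ (cup↓↑ ▷ u ∘ cap↑↓ ▷ u)
        ≈⟨ ◁-∘ u _ _ ⟩
      u ◁ (cup↓↑ ▷ u) ∘ u ◁ (cap↑↓ ▷ u) ∎

  uudd : Obj
  uudd = ↑ ∷ ↑ ∷ ↓ ∷ ↓ ∷ []

  ◁◁₂ : ∀ {b e} (f : Mor b e) → uu ◁ (dd ◁ f) ≈ uudd ◁ f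
  ◁◁₂ f = ≈-trans (≈-sym (⊗-assoc (idm uu) (idm dd) f)) (⊗-cong (⊗-idm uu dd) ≈-refl)

  -- After expanding `XR`, its cup and its crossing slide past the outer `cupN`, which then
  -- straightens against the cap of `XR`. A cup yields the rotation `XR` in this way, whereas a cap
  -- yields `XL` in `cap-rotate`.
  cup-rotate : uu ◁ XR ∘ cupN ≈ X ▷ dd ∘ cupN
  cup-rotate = begin
    uu ◁ XR ∘ cupN
      ≈⟨ ≈-trans (∘-congʳ (◁-∘₃ uu _ _ _)) (≈-trans (∘-assoc _ _ _) (∘-congˡ (∘-assoc _ _ _))) ⟩
    uu ◁ (capN ▷ dd) ∘ uu ◁ (dd ◁ (X ▷ dd)) ∘ uu ◁ (dd ◁ cupN) ∘ cupN
      ≈⟨ ∘-congˡ (∘-cong (◁◁₂ _) (≈-trans (∘-congʳ (◁◁₂ _)) (≈-trans (∘-congˡ (≈-sym (⊗-idʳ cupN))) (≈-sym (slide cupN cupN))))) ⟩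
    uu ◁ (capN ▷ dd) ∘ uudd ◁ (X ▷ dd) ∘ cupN ▷ uudd ∘ [] ◁ cupN
      ≈⟨ ∘-congˡ (swapᵖ (≈-sym (slide cupN (X ▷ dd)))) ⟩
    uu ◁ (capN ▷ dd) ∘ cupN ▷ uudd ∘ [] ◁ (X ▷ dd) ∘ [] ◁ cupN
      ≈⟨ cancelˡ straighten ⟩
    [] ◁ (X ▷ dd) ∘ [] ◁ cupN
      ≈⟨ ∘-cong (⊗-idˡ _) (⊗-idˡ _) ⟩
    X ▷ dd ∘ cupN ∎
    where
    straighten : uu ◁ (capN ▷ dd) ∘ cupN ▷ uudd ≈ idm uudd
    straighten = begin
      uu ◁ (capN ▷ dd) ∘ cupN ▷ uudd
        ≈⟨ ∘-cong (≈-sym (⊗-assoc (idm uu) capN (idm dd))) (≈-trans (⊗-cong ≈-refl (≈-sym (⊗-idm uu dd))) (≈-sym (⊗-assoc cupN (idm uu) (idm dd)))) ⟩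
      (uu ◁ capN) ▷ dd ∘ (cupN ▷ uu) ▷ dd
        ≈⟨ ≈-trans (≈-sym (▷-∘ _ _ dd)) (≈-trans (▷-cong dd zigzag-nested₁) (⊗-idm uu dd)) ⟩
      idm uudd ∎

  cap-rotate : capN' ∘ uu ◁ XL ≈ capN' ∘ X ▷ dd
  cap-rotate = begin
    capN' ∘ uu ◁ XL
      ≈⟨ ∘-congˡ (◁-∘₃ uu _ _ _) ⟩
    capN' ∘ uu ◁ (dd ◁ capN') ∘ uu ◁ ((dd ◁ X) ▷ dd) ∘ uu ◁ (cupN' ▷ dd)
      ≈⟨ ∘-congˡ (∘-cong (◁◁₂ _) (∘-congʳ (≈-trans (◁-cong uu (⊗-assoc (idm dd) X (idm dd))) (◁◁₂ _)))) ⟩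
    capN' ∘ uudd ◁ capN' ∘ uudd ◁ (X ▷ dd) ∘ uu ◁ (cupN' ▷ dd)
      ≈⟨ swapᵖ (≈-trans (∘-congʳ (≈-sym (⊗-idʳ capN'))) (≈-trans (slide capN' capN') (∘-congʳ (⊗-idˡ _)))) ⟩
    capN' ∘ capN' ▷ uudd ∘ uudd ◁ (X ▷ dd) ∘ uu ◁ (cupN' ▷ dd)
      ≈⟨ ∘-congˡ (swapᵖ (≈-trans (slide capN' (X ▷ dd)) (∘-congʳ (⊗-idˡ _)))) ⟩
    capN' ∘ X ▷ dd ∘ capN' ▷ uudd ∘ uu ◁ (cupN' ▷ dd)
      ≈⟨ ∘-congˡ (≈-trans (∘-congˡ straighten) (∘-idʳ _)) ⟩
    capN' ∘ X ▷ dd ∎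
    where
    straighten : capN' ▷ uudd ∘ uu ◁ (cupN' ▷ dd) ≈ idm uudd
    straighten = begin
      capN' ▷ uudd ∘ uu ◁ (cupN' ▷ dd)
        ≈⟨ ∘-cong (≈-trans (⊗-cong ≈-refl (≈-sym (⊗-idm uu dd))) (≈-sym (⊗-assoc capN' (idm uu) (idm dd)))) (≈-sym (⊗-assoc (idm uu) cupN' (idm dd))) ⟩
      (capN' ▷ uu) ▷ dd ∘ (uu ◁ cupN') ▷ dd
        ≈⟨ ≈-trans (≈-sym (▷-∘ _ _ dd)) (≈-trans (▷-cong dd zigzag-nested₃) (⊗-idm uu dd)) ⟩
      idm uudd ∎

  -- Crossings beside further strands, and nested arcs

  whisk : ∀ n {a b} → Mor a b → Mor (ups n ++ a) (ups n ++ b)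
  whisk zero    g = g
  whisk (suc n) g = u ◁ whisk n g

  whisk-∘ : ∀ n {a b e} (f : Mor b e) (g : Mor a b) → whisk n (f ∘ g) ≈ whisk n f ∘ whisk n g
  whisk-∘ zero    f g = ≈-refl
  whisk-∘ (suc n) f g = ≈-trans (◁-cong u (whisk-∘ n f g)) (◁-∘ u _ _)

  whisk-cong : ∀ n {a b} {f g : Mor a b} → f ≈ g → whisk n f ≈ whisk n g
  whisk-cong zero    p = p
  whisk-cong (suc n) p = ◁-cong u (whisk-cong n p)

  -- crossAt and crossW with further strands z to their right; recursing under the leftmost strand
  -- keeps all objects definitionally equal, so that no casts are needed.
  crossAtIn : ∀ {n} → Fin n → (z : Obj) → Mor (ups (suc n) ++ z) (ups (suc n) ++ z)
  crossAtIn {suc m} zero    z = X ▷ (ups m ++ z)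
  crossAtIn {suc m} (suc i) z = u ◁ crossAtIn i z

  crossIn : ∀ {n} → Word n → (z : Obj) → Mor (ups (suc n) ++ z) (ups (suc n) ++ z)
  crossIn {n} []      z = idm (ups (suc n) ++ z)
  crossIn     (i ∷ w) z = crossAtIn i z ∘ crossIn w z

  crossAt-▷ : ∀ {n} (i : Fin n) z → crossAt i ▷ z ≈ crossAtIn i z
  crossAt-▷ {suc m} zero    z = ≈-trans (⊗-assoc X (idm (ups m)) (idm z)) (⊗-cong ≈-refl (⊗-idm (ups m) z))
  crossAt-▷ {suc m} (suc i) z = ≈-trans (▷▷ ↑ (crossAt i) z) (◁-cong u (crossAt-▷ i z))

  crossW-▷ : ∀ {n} (w : Word n) z → crossW w ▷ z ≈ crossIn w z
  crossW-▷ {n} []      z = ⊗-idm (ups (suc n)) z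
  crossW-▷     (i ∷ w) z = ≈-trans (▷-∘ _ _ z) (∘-cong (crossAt-▷ i z) (crossW-▷ w z))

  crossIn-++ : ∀ {n} (w v : Word n) z → crossIn (w ++ v) z ≈ crossIn w z ∘ crossIn v z
  crossIn-++ []      v z = ≈-sym (∘-idˡ _)
  crossIn-++ (i ∷ w) v z = ≈-trans (∘-congˡ (crossIn-++ w v z)) (≈-sym (∘-assoc _ _ _))

  crossIn-suc : ∀ {n} (w : Word n) z → crossIn (map suc w) z ≈ u ◁ crossIn w z
  crossIn-suc {n} []      z = ≈-sym (⊗-idm u (ups (suc n) ++ z))
  crossIn-suc     (i ∷ w) z = ≈-trans (∘-congˡ (crossIn-suc w z)) (≈-sym (◁-∘ u _ _))

  crossAtIn-natural : ∀ {n} (i : Fin n) {a b} (g : Mor a b) →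
    crossAtIn i b ∘ whisk (suc n) g ≈ whisk (suc n) g ∘ crossAtIn i a
  crossAtIn-natural {suc m} zero    g = X-slide (whisk m g)
  crossAtIn-natural {suc m} (suc i) g = begin
    u ◁ crossAtIn i _ ∘ u ◁ whisk (suc m) g ≈⟨ ◁-∘ u _ _ ⟨
    u ◁ (crossAtIn i _ ∘ whisk (suc m) g)   ≈⟨ ◁-cong u (crossAtIn-natural i g) ⟩
    u ◁ (whisk (suc m) g ∘ crossAtIn i _)   ≈⟨ ◁-∘ u _ _ ⟩
    u ◁ whisk (suc m) g ∘ u ◁ crossAtIn i _ ∎

  crossIn-natural : ∀ {n} (w : Word n) {a b} (g : Mor a b) →
    crossIn w b ∘ whisk (suc n) g ≈ whisk (suc n) g ∘ crossIn w a
  crossIn-natural []      g = ≈-trans (∘-idˡ _) (≈-sym (∘-idʳ _))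
  crossIn-natural (i ∷ w) g = begin
    (crossAtIn i _ ∘ crossIn w _) ∘ whisk _ g ≈⟨ ∘-assoc _ _ _ ⟩
    crossAtIn i _ ∘ crossIn w _ ∘ whisk _ g   ≈⟨ ∘-congˡ (crossIn-natural w g) ⟩
    crossAtIn i _ ∘ whisk _ g ∘ crossIn w _   ≈⟨ swapᵖ (crossAtIn-natural i g) ⟩
    whisk _ g ∘ crossAtIn i _ ∘ crossIn w _   ∎

  -- The accumulator matches the nesting: peeling off the outermost arc leaves its downward end as
  -- the first letter of `z`. With it the recursive clauses of `caps` and `cups` typecheck without
  -- casts.
  downsOnto : ℕ → Obj → Obj
  downsOnto zero    z = z
  downsOnto (suc n) z = downsOnto n (↓ ∷ z)

  downsWhisk : ∀ n {a b} → Mor a b → Mor (downsOnto n a) (downsOnto n b)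
  downsWhisk zero    g = g
  downsWhisk (suc n) g = downsWhisk n (d ◁ g)

  caps : ∀ n z → Mor (ups n ++ downsOnto n z) z
  caps zero    z = idm z
  caps (suc n) z = cap↑↓ ▷ z ∘ u ◁ caps n (↓ ∷ z)

  cups : ∀ n z → Mor z (ups n ++ downsOnto n z)
  cups zero    z = idm z
  cups (suc n) z = u ◁ cups n (↓ ∷ z) ∘ cup↑↓ ▷ z

  cap-slide : ∀ {a b} (g : Mor a b) → g ∘ cap↑↓ ▷ a ≈ cap↑↓ ▷ b ∘ u ◁ (d ◁ g)
  cap-slide g = begin
    g ∘ cap↑↓ ▷ _             ≈⟨ ∘-congʳ (⊗-idˡ g) ⟨
    [] ◁ g ∘ cap↑↓ ▷ _        ≈⟨ slide cap↑↓ g ⟨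
    cap↑↓ ▷ _ ∘ ud ◁ g        ≈⟨ ∘-congˡ (◁◁ ↑ ↓ g) ⟨
    cap↑↓ ▷ _ ∘ u ◁ (d ◁ g)   ∎

  cup-slide : ∀ {a b} (g : Mor a b) → cup↑↓ ▷ b ∘ g ≈ u ◁ (d ◁ g) ∘ cup↑↓ ▷ a
  cup-slide g = begin
    cup↑↓ ▷ _ ∘ g             ≈⟨ ∘-congˡ (⊗-idˡ g) ⟨
    cup↑↓ ▷ _ ∘ [] ◁ g        ≈⟨ slide cup↑↓ g ⟩
    ud ◁ g ∘ cup↑↓ ▷ _        ≈⟨ ∘-congʳ (◁◁ ↑ ↓ g) ⟨
    u ◁ (d ◁ g) ∘ cup↑↓ ▷ _   ∎

  caps-natural : ∀ n {a b} (g : Mor a b) → g ∘ caps n a ≈ caps n b ∘ whisk n (downsWhisk n g)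
  caps-natural zero    g = ≈-trans (∘-idʳ g) (≈-sym (∘-idˡ g))
  caps-natural (suc n) g = begin
    g ∘ cap↑↓ ▷ _ ∘ u ◁ caps n _
      ≈⟨ swapᵖ (cap-slide g) ⟩
    cap↑↓ ▷ _ ∘ u ◁ (d ◁ g) ∘ u ◁ caps n _
      ≈⟨ ∘-congˡ (≈-trans (≈-sym (◁-∘ u _ _)) (≈-trans (◁-cong u (caps-natural n (d ◁ g))) (◁-∘ u _ _))) ⟩
    cap↑↓ ▷ _ ∘ u ◁ caps n _ ∘ whisk (suc n) (downsWhisk (suc n) g)
      ≈⟨ ∘-assoc _ _ _ ⟨
    caps (suc n) _ ∘ whisk (suc n) (downsWhisk (suc n) g) ∎

  cups-natural : ∀ n {a b} (g : Mor a b) → cups n b ∘ g ≈ whisk n (downsWhisk n g) ∘ cups n a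
  cups-natural zero    g = ≈-trans (∘-idˡ g) (≈-sym (∘-idʳ g))
  cups-natural (suc n) g = begin
    (u ◁ cups n _ ∘ cup↑↓ ▷ _) ∘ g
      ≈⟨ ≈-trans (∘-assoc _ _ _) (∘-congˡ (cup-slide g)) ⟩
    u ◁ cups n _ ∘ u ◁ (d ◁ g) ∘ cup↑↓ ▷ _
      ≈⟨ swapᵖ (≈-trans (≈-sym (◁-∘ u _ _)) (≈-trans (◁-cong u (cups-natural n (d ◁ g))) (◁-∘ u _ _))) ⟩
    whisk (suc n) (downsWhisk (suc n) g) ∘ cups (suc n) _ ∎

  -- The crossing of strands i, i+1 transported to the downward strands that caps and cups join them to.
  mirror : ∀ {n} → Fin n → (z : Obj) → Mor (downsOnto (suc n) z) (downsOnto (suc n) z)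
  mirror {suc m} zero    z = downsWhisk m (XL ▷ z)
  mirror {suc m} (suc i) z = mirror i (↓ ∷ z)

  capN'-▷ : ∀ z → capN' ▷ z ≈ cap↑↓ ▷ z ∘ u ◁ (cap↑↓ ▷ (↓ ∷ z))
  capN'-▷ z = begin
    capN' ▷ z                                ≈⟨ ▷-∘ _ _ z ⟩
    cap↑↓ ▷ z ∘ (u ◁ (cap↑↓ ▷ d)) ▷ z        ≈⟨ ∘-congˡ (≈-trans (▷▷ ↑ _ z) (◁-cong u (≈-trans (⊗-assoc cap↑↓ id↓ (idm z)) (⊗-cong ≈-refl (⊗-idm d z))))) ⟩
    cap↑↓ ▷ z ∘ u ◁ (cap↑↓ ▷ (↓ ∷ z))        ∎

  cupN-▷ : ∀ z → cupN ▷ z ≈ u ◁ (cup↑↓ ▷ (↓ ∷ z)) ∘ cup↑↓ ▷ z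
  cupN-▷ z = begin
    cupN ▷ z                                 ≈⟨ ▷-∘ _ _ z ⟩
    (u ◁ (cup↑↓ ▷ d)) ▷ z ∘ cup↑↓ ▷ z        ≈⟨ ∘-congʳ (≈-trans (▷▷ ↑ _ z) (◁-cong u (≈-trans (⊗-assoc cup↑↓ id↓ (idm z)) (⊗-cong ≈-refl (⊗-idm d z))))) ⟩
    u ◁ (cup↑↓ ▷ (↓ ∷ z)) ∘ cup↑↓ ▷ z        ∎

  caps-two : ∀ m z → caps (suc (suc m)) z ≈ capN' ▷ z ∘ u ◁ (u ◁ caps m (↓ ∷ ↓ ∷ z))
  caps-two m z = begin
    cap↑↓ ▷ z ∘ u ◁ (cap↑↓ ▷ (↓ ∷ z) ∘ u ◁ caps m _)        ≈⟨ ∘-congˡ (◁-∘ u _ _) ⟩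
    cap↑↓ ▷ z ∘ u ◁ (cap↑↓ ▷ (↓ ∷ z)) ∘ u ◁ (u ◁ caps m _)  ≈⟨ pull (≈-sym (capN'-▷ z)) ⟩
    capN' ▷ z ∘ u ◁ (u ◁ caps m _)                          ∎

  cups-two : ∀ m z → cups (suc (suc m)) z ≈ u ◁ (u ◁ cups m (↓ ∷ ↓ ∷ z)) ∘ cupN ▷ z
  cups-two m z = begin
    u ◁ (u ◁ cups m _ ∘ cup↑↓ ▷ (↓ ∷ z)) ∘ cup↑↓ ▷ z          ≈⟨ ∘-congʳ (◁-∘ u _ _) ⟩
    (u ◁ (u ◁ cups m _) ∘ u ◁ (cup↑↓ ▷ (↓ ∷ z))) ∘ cup↑↓ ▷ z  ≈⟨ ≈-trans (∘-assoc _ _ _) (∘-congˡ (≈-sym (cupN-▷ z))) ⟩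
    u ◁ (u ◁ cups m _) ∘ cupN ▷ z                             ∎

  ◁◁-uu : ∀ {b e} (f : Mor b e) z → (uu ◁ f) ▷ z ≈ u ◁ (u ◁ (f ▷ z))
  ◁◁-uu f z = ≈-trans (⊗-assoc (idm uu) f (idm z)) (≈-sym (◁◁ ↑ ↑ _))

  X▷dd : ∀ z → (X ▷ dd) ▷ z ≈ X ▷ (↓ ∷ ↓ ∷ z)
  X▷dd z = ≈-trans (⊗-assoc X (idm dd) (idm z)) (⊗-cong ≈-refl (⊗-idm dd z))

  caps-mirror : ∀ {n} (i : Fin n) z → caps (suc n) z ∘ crossAtIn i (downsOnto (suc n) z)
                                    ≈ caps (suc n) z ∘ whisk (suc n) (mirror i z)
  caps-mirror {suc m} zero z = begin
    caps (suc (suc m)) z ∘ X ▷ _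
      ≈⟨ ≈-trans (∘-congʳ (caps-two m z)) (∘-assoc _ _ _) ⟩
    capN' ▷ z ∘ u ◁ (u ◁ caps m _) ∘ X ▷ _
      ≈⟨ ∘-congˡ (X-slide (caps m _)) ⟨
    capN' ▷ z ∘ X ▷ (↓ ∷ ↓ ∷ z) ∘ u ◁ (u ◁ caps m _)
      ≈⟨ swapᵖ (≈-trans (∘-congˡ (≈-sym (X▷dd z))) (≈-trans (≈-sym (▷-∘ _ _ z))
           (≈-trans (▷-cong z (≈-sym cap-rotate)) (≈-trans (▷-∘ _ _ z) (∘-congˡ (◁◁-uu XL z)))))) ⟩
    capN' ▷ z ∘ u ◁ (u ◁ (XL ▷ z)) ∘ u ◁ (u ◁ caps m _)
      ≈⟨ ∘-congˡ (≈-trans (≈-sym (whisk-∘ 2 _ _)) (≈-trans (whisk-cong 2 (caps-natural m (XL ▷ z))) (whisk-∘ 2 _ _))) ⟩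
    capN' ▷ z ∘ u ◁ (u ◁ caps m _) ∘ whisk (suc (suc m)) (mirror {suc m} zero z)
      ≈⟨ ≈-trans (≈-sym (∘-assoc _ _ _)) (∘-congʳ (≈-sym (caps-two m z))) ⟩
    caps (suc (suc m)) z ∘ whisk (suc (suc m)) (mirror {suc m} zero z) ∎
  caps-mirror {suc m} (suc i) z = begin
    (cap↑↓ ▷ z ∘ u ◁ caps (suc m) _) ∘ u ◁ crossAtIn i _
      ≈⟨ ≈-trans (∘-assoc _ _ _) (∘-congˡ (≈-sym (◁-∘ u _ _))) ⟩
    cap↑↓ ▷ z ∘ u ◁ (caps (suc m) _ ∘ crossAtIn i _)
      ≈⟨ ∘-congˡ (≈-trans (◁-cong u (caps-mirror i (↓ ∷ z))) (◁-∘ u _ _)) ⟩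
    cap↑↓ ▷ z ∘ u ◁ caps (suc m) _ ∘ whisk (suc (suc m)) (mirror i (↓ ∷ z))
      ≈⟨ ∘-assoc _ _ _ ⟨
    caps (suc (suc m)) z ∘ whisk (suc (suc m)) (mirror i (↓ ∷ z)) ∎

  cups-mirror : ∀ {n} (i : Fin n) z → crossAtIn i (downsOnto (suc n) z) ∘ cups (suc n) z
                                    ≈ whisk (suc n) (mirror i z) ∘ cups (suc n) z
  cups-mirror {suc m} zero z = begin
    X ▷ _ ∘ cups (suc (suc m)) z
      ≈⟨ ∘-congˡ (cups-two m z) ⟩
    X ▷ _ ∘ u ◁ (u ◁ cups m _) ∘ cupN ▷ z
      ≈⟨ swapᵖ (X-slide (cups m _)) ⟩
    u ◁ (u ◁ cups m _) ∘ X ▷ (↓ ∷ ↓ ∷ z) ∘ cupN ▷ z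
      -- The cup produces `XR`; `cyclic` replaces it by the `XL` of `mirror`, so that cups and caps
      -- share the same mirror image.
      ≈⟨ ∘-congˡ (≈-trans (∘-congʳ (≈-sym (X▷dd z))) (≈-trans (≈-sym (▷-∘ _ _ z))
           (≈-trans (▷-cong z (≈-trans (≈-sym cup-rotate) (∘-congʳ (◁-cong uu cyclic))))
             (≈-trans (▷-∘ _ _ z) (∘-congʳ (◁◁-uu XL z)))))) ⟩
    u ◁ (u ◁ cups m _) ∘ u ◁ (u ◁ (XL ▷ z)) ∘ cupN ▷ z
      ≈⟨ swapᵖ (≈-trans (≈-sym (whisk-∘ 2 _ _)) (≈-trans (whisk-cong 2 (cups-natural m (XL ▷ z))) (whisk-∘ 2 _ _))) ⟩
    whisk (suc (suc m)) (mirror {suc m} zero z) ∘ u ◁ (u ◁ cups m _) ∘ cupN ▷ z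
      ≈⟨ ∘-congˡ (cups-two m z) ⟨
    whisk (suc (suc m)) (mirror {suc m} zero z) ∘ cups (suc (suc m)) z ∎
  cups-mirror {suc m} (suc i) z = begin
    u ◁ crossAtIn i _ ∘ u ◁ cups (suc m) _ ∘ cup↑↓ ▷ z
      ≈⟨ swapᵖ (≈-trans (≈-sym (◁-∘ u _ _)) (≈-trans (◁-cong u (cups-mirror i (↓ ∷ z))) (◁-∘ u _ _))) ⟩
    whisk (suc (suc m)) (mirror i (↓ ∷ z)) ∘ cups (suc (suc m)) z ∎

  -- Closures and their invariance under rotation

  closure : ∀ n → Mor (ups (suc n) ++ downsOnto n []) (ups (suc n) ++ downsOnto n []) → Mor u u
  closure n f = u ◁ caps n [] ∘ f ∘ u ◁ cups n []

  closure-cong : ∀ n {f g} → f ≈ g → closure n f ≈ closure n g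
  closure-cong n p = ∘-congˡ (∘-congʳ p)

  closeW : ∀ {n} → Word n → Mor u u
  closeW {n} w = closure n (crossIn w (downsOnto n []))

  -- The crossing travels around the closing arcs: over the caps to the downward strands, past `w`,
  -- which lives on other strands, and back through the cups to the bottom.
  closeW-rotate : ∀ {n} (i : Fin n) (w : Word (suc n)) → closeW (suc i ∷ w) ≈ closeW (w ++ suc i ∷ [])
  closeW-rotate {n} i w = begin
    u ◁ caps (suc n) [] ∘ (u ◁ crossAtIn i D ∘ crossIn w D) ∘ u ◁ cups (suc n) []
      ≈⟨ ∘-congˡ (∘-assoc _ _ _) ⟩
    u ◁ caps (suc n) [] ∘ u ◁ crossAtIn i D ∘ crossIn w D ∘ u ◁ cups (suc n) []
      ≈⟨ swapᵖ (≈-trans (≈-sym (◁-∘ u _ _)) (≈-trans (◁-cong u (caps-mirror i [])) (◁-∘ u _ _))) ⟩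
    u ◁ caps (suc n) [] ∘ whisk (suc (suc n)) (mirror i []) ∘ crossIn w D ∘ u ◁ cups (suc n) []
      ≈⟨ ∘-congˡ (swapᵖ (≈-sym (crossIn-natural w (mirror i [])))) ⟩
    u ◁ caps (suc n) [] ∘ crossIn w D ∘ whisk (suc (suc n)) (mirror i []) ∘ u ◁ cups (suc n) []
      ≈⟨ ∘-congˡ (∘-congˡ (≈-trans (≈-sym (◁-∘ u _ _)) (≈-trans (◁-cong u (≈-sym (cups-mirror i []))) (◁-∘ u _ _)))) ⟩
    u ◁ caps (suc n) [] ∘ crossIn w D ∘ u ◁ crossAtIn i D ∘ u ◁ cups (suc n) []
      ≈⟨ ∘-congˡ (pull (≈-trans (∘-congˡ (≈-sym (∘-idʳ _))) (≈-sym (crossIn-++ w (suc i ∷ []) D)))) ⟩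
    u ◁ caps (suc n) [] ∘ crossIn (w ++ suc i ∷ []) D ∘ u ◁ cups (suc n) [] ∎
    where D = downsOnto (suc n) []

  -- Moving a dot past all closed strands

  crossIn-star-suc : ∀ {n} (j : Fin n) z → crossIn (star (suc j)) z
    ≈ X ▷ (ups n ++ z) ∘ u ◁ crossIn (star j) z ∘ X ▷ (ups n ++ z)
  crossIn-star-suc j z = ∘-congˡ (≈-trans (crossIn-++ (map suc (star j)) (zero ∷ []) z)
    (∘-cong (crossIn-suc (star j) z) (∘-idʳ _)))

  -- The diagram of `star (fromℕ n)`, typed so that the last strand stands next to `z`; there a cup
  -- can create it, and a cap can absorb it, together with a downward strand.
  crossOuter : ∀ n z → Mor (↑ ∷ ups n ++ ↑ ∷ z) (↑ ∷ ups n ++ ↑ ∷ z)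
  crossOuter zero    z = X ▷ z
  crossOuter (suc n) z = X ▷ (ups n ++ ↑ ∷ z) ∘ u ◁ crossOuter n z ∘ X ▷ (ups n ++ ↑ ∷ z)

  -- The open strand with its curl stretched across `n` neighbours: its loop lies to their right. It
  -- is the dot on the last strand, conjugated back to the first by the intervening crossings.
  bigCurl : ∀ n z → Mor (↑ ∷ ups n ++ z) (↑ ∷ ups n ++ z)
  bigCurl n z = u ◁ whisk n (cap↑↓ ▷ z) ∘ crossOuter n (↓ ∷ z) ∘ u ◁ whisk n (cup↑↓ ▷ z)

  bigCurl-zero : ∀ z → dot ▷ z ≈ bigCurl zero z
  bigCurl-zero z = ≈-trans (▷-∘₃ _ _ _ z) (∘-cong (▷▷ ↑ _ z)
    (∘-cong (≈-trans (⊗-assoc X id↓ (idm z)) (⊗-cong ≈-refl (⊗-idm d z))) (▷▷ ↑ _ z)))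

  bigCurl-suc : ∀ n z → X ▷ (ups n ++ z) ∘ u ◁ bigCurl n z ∘ X ▷ (ups n ++ z) ≈ bigCurl (suc n) z
  bigCurl-suc n z = begin
    X ▷ _ ∘ u ◁ bigCurl n z ∘ X ▷ _
      ≈⟨ ∘-congˡ (≈-trans (∘-congʳ (◁-∘₃ u _ _ _)) (≈-trans (∘-assoc _ _ _) (∘-congˡ (∘-assoc _ _ _)))) ⟩
    X ▷ _ ∘ u ◁ (u ◁ whisk n (cap↑↓ ▷ z)) ∘ u ◁ crossOuter n _ ∘ u ◁ (u ◁ whisk n (cup↑↓ ▷ z)) ∘ X ▷ _
      ≈⟨ ≈-trans (swapᵖ (X-slide _)) (∘-congˡ (∘-congˡ (∘-congˡ (≈-sym (X-slide _))))) ⟩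
    u ◁ (u ◁ whisk n (cap↑↓ ▷ z)) ∘ X ▷ _ ∘ u ◁ crossOuter n _ ∘ X ▷ _ ∘ u ◁ (u ◁ whisk n (cup↑↓ ▷ z))
      ≈⟨ ∘-congˡ (≈-trans (∘-congˡ (≈-sym (∘-assoc _ _ _))) (≈-sym (∘-assoc _ _ _))) ⟩
    bigCurl (suc n) z ∎

  sumM-cong : ∀ {a b} n {f g : Fin n → Mor a b} → (∀ j → f j ≈ g j) → sumM (tabulate f) ≈ sumM (tabulate g)
  sumM-cong zero    p = ≈-refl
  sumM-cong (suc n) p = +-cong (p zero) (sumM-cong n (λ j → p (suc j)))

  record Additive {a b a' b'} (F : Mor a b → Mor a' b') : Set (c ⊔ ℓ) where
    field
      resp : ∀ {f g} → f ≈ g → F f ≈ F g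
      add  : ∀ f g → F (f +ₘ g) ≈ F f +ₘ F g
      null : F zer ≈ zer

    sum : ∀ n (f : Fin n → Mor a b) → F (sumM (tabulate f)) ≈ sumM (tabulate (λ j → F (f j)))
    sum zero    f = null
    sum (suc n) f = ≈-trans (add _ _) (+-congˡ (sum n (λ j → f (suc j))))

  sandwich-additive : ∀ {a b a' b'} (h : Mor b b') (k : Mor a' a) → Additive (λ f → h ∘ f ∘ k)
  sandwich-additive h k = record
    { resp = λ p → ∘-congˡ (∘-congʳ p)
    ; add  = λ f g → ≈-trans (∘-congˡ (∘-distʳ f g k)) (∘-distˡ h _ _)
    ; null = ≈-trans (∘-congˡ (∘-zerˡ k)) (∘-zerʳ h)
    }

  precompose-additive : ∀ {a b d} (k : Mor a b) → Additive {b} {d} (_∘ k)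
  precompose-additive k = record { resp = ∘-congʳ ; add = λ f g → ∘-distʳ f g k ; null = ∘-zerˡ k }

  ◁-additive : ∀ a {b d} → Additive {b} {d} (a ◁_)
  ◁-additive a = record { resp = ◁-cong a ; add = ⊗-distˡ _ ; null = ⊗-zerʳ _ }

  -- Iterated Hecke relation. Each application contributes one new `X`, the first star, and
  -- conjugation by `X` carries every earlier star to the next one; the sum is the Jucys-Murphy type
  -- element formed by all (0 j+1).
  dot-expand : ∀ n z → dot ▷ (ups n ++ z) ≈ bigCurl n z +ₘ sumM (tabulate {n = n} (λ j → crossIn (star j) z))
  dot-expand zero    z = ≈-trans (bigCurl-zero z) (≈-sym (+-idʳ _))
  dot-expand (suc n) z = begin
    dot ▷ (↑ ∷ e)
      ≈⟨ ≈-trans (⊗-cong ≈-refl (≈-sym (⊗-idm u e))) (≈-sym (⊗-assoc dot id↑ (idm e))) ⟩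
    (dot ▷ u) ▷ e
      ≈⟨ ▷-cong e hecke ⟩
    (X ∘ u ◁ dot ∘ X +ₘ X) ▷ e
      ≈⟨ ≈-trans (⊗-distʳ _ _ _) (+-congʳ (≈-trans (▷-∘₃ _ _ _ e) (∘-congˡ (∘-congʳ (▷▷ ↑ dot e))))) ⟩
    Conj (u ◁ (dot ▷ e)) +ₘ X ▷ e
      ≈⟨ +-congʳ (C.resp (U.resp (dot-expand n z))) ⟩
    Conj (u ◁ (bigCurl n z +ₘ sumM (tabulate {n = n} (λ j → crossIn (star j) z)))) +ₘ X ▷ e
      ≈⟨ +-congʳ (≈-trans (C.resp (≈-trans (U.add _ _) (+-congˡ (U.sum n _)))) (≈-trans (C.add _ _) (+-congˡ (C.sum n _)))) ⟩
    (Conj (u ◁ bigCurl n z) +ₘ sumM (tabulate {n = n} (λ j → Conj (u ◁ crossIn (star j) z)))) +ₘ X ▷ e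
      ≈⟨ ≈-trans (+-assoc _ _ _) (+-cong (bigCurl-suc n z) (≈-trans (+-comm _ _)
          (+-cong (≈-sym (∘-idʳ _)) (sumM-cong n (λ j → ≈-sym (crossIn-star-suc j z)))))) ⟩
    bigCurl (suc n) z +ₘ sumM (tabulate {n = suc n} (λ j → crossIn (star j) z)) ∎
    where
    e = ups n ++ z
    Conj : Mor (↑ ∷ ↑ ∷ e) (↑ ∷ ↑ ∷ e) → Mor (↑ ∷ ↑ ∷ e) (↑ ∷ ↑ ∷ e)
    Conj f = X ▷ e ∘ f ∘ X ▷ e
    module C = Additive (sandwich-additive (X ▷ e) (X ▷ e))
    module U = Additive (◁-additive u {↑ ∷ e} {↑ ∷ e})

  -- Morphisms over propositionally equal objects

  infix 4 _≋_
  -- Objects such as `ups n ++ ↑ ∷ z` and `↑ ∷ ups n ++ z` agree only propositionally. Since the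
  -- right-hand objects are free indices, congruences compose here without any `castM`, and `≋⇒≈`
  -- returns to `≈` once both ends have the same type.
  data _≋_ {a b} (f : Mor a b) : ∀ {a' b'} → Mor a' b' → Set (c ⊔ ℓ) where
    het : ∀ {g : Mor a b} → f ≈ g → f ≋ g

  ≋⇒≈ : ∀ {a b} {f g : Mor a b} → f ≋ g → f ≈ g
  ≋⇒≈ (het p) = p

  ≋-trans : ∀ {a b a' b' a'' b''} {f : Mor a b} {g : Mor a' b'} {h : Mor a'' b''} → f ≋ g → g ≋ h → f ≋ h
  ≋-trans (het p) (het q) = het (≈-trans p q)

  ≋-sym : ∀ {a b a' b'} {f : Mor a b} {g : Mor a' b'} → f ≋ g → g ≋ f
  ≋-sym (het p) = het (≈-sym p)

  ≋-∘ : ∀ {a b e a' b' e'} {f : Mor b e} {g : Mor a b} {f' : Mor b' e'} {g' : Mor a' b'} →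
        f ≋ f' → g ≋ g' → f ∘ g ≋ f' ∘ g'
  ≋-∘ (het p) (het q) = het (∘-cong p q)

  ≋-⊗ : ∀ {a b e h a' b' e' h'} {f : Mor a b} {g : Mor e h} {f' : Mor a' b'} {g' : Mor e' h'} →
        f ≋ f' → g ≋ g' → f ⊗ g ≋ f' ⊗ g'
  ≋-⊗ (het p) (het q) = het (⊗-cong p q)

  ≋-◁ : ∀ a {b e b' e'} {f : Mor b e} {g : Mor b' e'} → f ≋ g → a ◁ f ≋ a ◁ g
  ≋-◁ a = ≋-⊗ (het ≈-refl)

  ≋-idm : ∀ {a b} → a ≡ b → idm a ≋ idm b
  ≋-idm refl = het ≈-refl

  ≋-castM : ∀ {a a' b b'} (p : a ≡ a') (q : b ≡ b') (f : Mor a b) → castM p q f ≋ f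
  ≋-castM refl refl f = het ≈-refl

  ▷-≋ : ∀ {a b z z'} (f : Mor a b) → z ≡ z' → f ▷ z ≋ f ▷ z'
  ▷-≋ f refl = het ≈-refl

  ups-shift : ∀ n z → ups n ++ ↑ ∷ z ≡ ↑ ∷ ups n ++ z
  ups-shift zero    z = refl
  ups-shift (suc n) z = cong (↑ ∷_) (ups-shift n z)

  downsOnto-↓ : ∀ n z → downsOnto n (↓ ∷ z) ≡ ↓ ∷ downsOnto n z
  downsOnto-↓ zero    z = refl
  downsOnto-↓ (suc n) z = downsOnto-↓ n (↓ ∷ z)

  downsOnto-++ : ∀ n z → downsOnto n z ≡ downs n ++ z
  downsOnto-++ zero    z = refl
  downsOnto-++ (suc n) z = trans (downsOnto-↓ n z) (cong (↓ ∷_) (downsOnto-++ n z))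

  -- The recursion of `caps` peels off the outermost arc, but a curl opens an innermost one. This
  -- lemma and `cups-inner` reconcile the two.
  caps-inner : ∀ n z → caps n z ∘ whisk n (cap↑↓ ▷ downsOnto n z) ≋ caps (suc n) z
  caps-inner zero    z = het (≈-trans (∘-idˡ _) (≈-sym (≈-trans (∘-congˡ (⊗-idm u _)) (∘-idʳ _))))
  caps-inner (suc n) z = ≋-trans (het (≈-trans (∘-assoc _ _ _) (∘-congˡ (≈-sym (◁-∘ u _ _)))))
    (≋-∘ (het ≈-refl) (≋-◁ u (caps-inner n (↓ ∷ z))))

  cups-inner : ∀ n z → whisk n (cup↑↓ ▷ downsOnto n z) ∘ cups n z ≋ cups (suc n) z
  cups-inner zero    z = het (≈-trans (∘-idʳ _) (≈-sym (≈-trans (∘-congʳ (⊗-idm u _)) (∘-idˡ _))))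
  cups-inner (suc n) z = ≋-trans (het (≈-trans (≈-sym (∘-assoc _ _ _)) (∘-congʳ (≈-sym (◁-∘ u _ _)))))
    (≋-∘ (≋-◁ u (cups-inner n (↓ ∷ z))) (het ≈-refl))

  crossOuter-star : ∀ n z → crossOuter n z ≋ crossIn (star (fromℕ n)) z
  crossOuter-star zero    z = het (≈-sym (∘-idʳ _))
  crossOuter-star (suc n) z = ≋-trans
    (≋-∘ (▷-≋ X (ups-shift n z)) (≋-∘ (≋-◁ u (crossOuter-star n z)) (▷-≋ X (ups-shift n z))))
    (het (≈-sym (crossIn-star-suc (fromℕ n) z)))

  crossAtIn-inject₁ : ∀ {n} (i : Fin n) z → crossAtIn i (↑ ∷ z) ≋ crossAtIn (inject₁ i) z
  crossAtIn-inject₁ {suc m} zero    z = ▷-≋ X (ups-shift m z)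
  crossAtIn-inject₁ {suc m} (suc i) z = ≋-◁ u (crossAtIn-inject₁ i z)

  crossIn-inject₁ : ∀ {n} (w : Word n) z → crossIn w (↑ ∷ z) ≋ crossIn (map inject₁ w) z
  crossIn-inject₁ {n} []      z = ≋-idm (ups-shift (suc n) z)
  crossIn-inject₁     (i ∷ w) z = ≋-∘ (crossAtIn-inject₁ i z) (crossIn-inject₁ w z)

  crossIn-≋ : ∀ {n} (w : Word n) {z z'} → z ≡ z' → crossIn w z ≋ crossIn w z'
  crossIn-≋ w refl = het ≈-refl

  -- The cup of the curl slides down below `w` by naturality. Cap and cup then form the innermost
  -- arc of a larger closure, and `w` acquires an uncrossed last strand, which is `map inject₁`.
  closure-bigCurl : ∀ {n} (w : Word n) → closure n (bigCurl n (downsOnto n []) ∘ crossIn w (downsOnto n []))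
                                       ≈ closeW (star (fromℕ n) ++ map inject₁ w)
  closure-bigCurl {n} w = begin
    u ◁ caps n [] ∘ ((u ◁ whisk n (cap↑↓ ▷ D) ∘ crossOuter n (↓ ∷ D) ∘ u ◁ whisk n (cup↑↓ ▷ D)) ∘ crossIn w D) ∘ u ◁ cups n []
      ≈⟨ ∘-congˡ (≈-trans (∘-assoc _ _ _) (≈-trans (∘-assoc _ _ _) (∘-congˡ (∘-assoc _ _ _)))) ⟩
    u ◁ caps n [] ∘ u ◁ whisk n (cap↑↓ ▷ D) ∘ crossOuter n (↓ ∷ D) ∘ u ◁ whisk n (cup↑↓ ▷ D) ∘ crossIn w D ∘ u ◁ cups n []
      ≈⟨ ∘-congˡ (∘-congˡ (∘-congˡ (swapᵖ (≈-sym (crossIn-natural w (cup↑↓ ▷ D)))))) ⟩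
    u ◁ caps n [] ∘ u ◁ whisk n (cap↑↓ ▷ D) ∘ crossOuter n (↓ ∷ D) ∘ crossIn w (↑ ∷ ↓ ∷ D) ∘ u ◁ whisk n (cup↑↓ ▷ D) ∘ u ◁ cups n []
      ≈⟨ ≈-trans (pull (≈-sym (◁-∘ u _ _))) (∘-congˡ (∘-congˡ (∘-congˡ (≈-sym (◁-∘ u _ _))))) ⟩
    u ◁ (caps n [] ∘ whisk n (cap↑↓ ▷ D)) ∘ crossOuter n (↓ ∷ D) ∘ crossIn w (↑ ∷ ↓ ∷ D) ∘ u ◁ (whisk n (cup↑↓ ▷ D) ∘ cups n [])
      ≈⟨ ≋⇒≈ (≋-∘ (≋-◁ u (caps-inner n []))
              (≋-∘ (≋-trans (crossOuter-star n (↓ ∷ D)) (crossIn-≋ (star (fromℕ n)) D≡))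
                (≋-∘ (≋-trans (crossIn-inject₁ w (↓ ∷ D)) (crossIn-≋ (map inject₁ w) D≡))
                  (≋-◁ u (cups-inner n []))))) ⟩
    u ◁ caps (suc n) [] ∘ crossIn (star (fromℕ n)) D' ∘ crossIn (map inject₁ w) D' ∘ u ◁ cups (suc n) []
      ≈⟨ ∘-congˡ (pull (≈-sym (crossIn-++ (star (fromℕ n)) (map inject₁ w) D'))) ⟩
    closeW (star (fromℕ n) ++ map inject₁ w) ∎
    where
    D  = downsOnto n []
    D' = downsOnto (suc n) []
    D≡ : ↓ ∷ D ≡ D'
    D≡ = sym (downsOnto-↓ n [])

  -- The dot sits on the open strand, so it slides below the caps and stands directly on the
  -- crossings, where `dot-expand` applies.
  dot-closeW : ∀ {n} (w : Word n) → dot ∘ closeW w ≈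
    closeW (star (fromℕ n) ++ map inject₁ w) +ₘ sumM (tabulate {n = n} (λ j → closeW (star j ++ w)))
  dot-closeW {n} w = begin
    dot ∘ u ◁ caps n [] ∘ crossIn w D ∘ u ◁ cups n []
      ≈⟨ swapᵖ (≈-trans (∘-congʳ (≈-sym (⊗-idʳ dot))) (slide dot (caps n []))) ⟩
    u ◁ caps n [] ∘ dot ▷ (ups n ++ D) ∘ crossIn w D ∘ u ◁ cups n []
      ≈⟨ ∘-congˡ (∘-assoc _ _ _) ⟨
    closure n (dot ▷ (ups n ++ D) ∘ crossIn w D)
      ≈⟨ closure-cong n (∘-congʳ (dot-expand n D)) ⟩
    closure n ((bigCurl n D +ₘ sumM (tabulate {n = n} (λ j → crossIn (star j) D))) ∘ crossIn w D)
      ≈⟨ closure-cong n (≈-trans (W.add _ _) (+-congˡ (W.sum n _))) ⟩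
    closure n (bigCurl n D ∘ crossIn w D +ₘ sumM (tabulate {n = n} (λ j → crossIn (star j) D ∘ crossIn w D)))
      ≈⟨ ≈-trans (T.add _ _) (+-congˡ (T.sum n _)) ⟩
    closure n (bigCurl n D ∘ crossIn w D) +ₘ sumM (tabulate {n = n} (λ j → closure n (crossIn (star j) D ∘ crossIn w D)))
      ≈⟨ +-cong (closure-bigCurl w) (sumM-cong n (λ j → closure-cong n (≈-sym (crossIn-++ (star j) w D)))) ⟩
    closeW (star (fromℕ n) ++ map inject₁ w) +ₘ sumM (tabulate {n = n} (λ j → closeW (star j ++ w))) ∎
    where
    D = downsOnto n []
    module T = Additive (sandwich-additive (u ◁ caps n []) (u ◁ cups n []))
    module W = Additive (precompose-additive (crossIn w D))

  -- Agreement with the partial closure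

  ⊗-assoc-≋ : ∀ {a b a' b' a'' b''} (f : Mor a b) (g : Mor a' b') (h : Mor a'' b'') →
              (f ⊗ g) ⊗ h ≋ f ⊗ (g ⊗ h)
  ⊗-assoc-≋ f g h = ≋-trans (≋-sym (≋-castM _ _ _)) (het (⊗-assoc f g h))

  ▷▷-≋ : ∀ {a b} (f : Mor a b) s z → (f ▷ (s ∷ [])) ▷ z ≋ f ▷ (s ∷ z)
  ▷▷-≋ f s z = ≋-trans (⊗-assoc-≋ f _ _) (het (⊗-cong ≈-refl (⊗-idm (s ∷ []) z)))

  -- Generalised to an arbitrary `z` for the sake of the induction: `z` collects the downward ends
  -- of the arcs already peeled off.
  capNest-▷ : ∀ n z → capNest n ▷ z ≋ caps n z
  capNest-▷ zero    z = het (⊗-idˡ _)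
  capNest-▷ (suc n) z = ≋-trans (≋-⊗ (≋-castM _ refl _) (het ≈-refl))
    (≋-trans (het (≈-trans (▷-∘ _ _ z) (∘-congˡ (▷▷ ↑ _ z))))
      (≋-∘ (het ≈-refl) (≋-◁ u (≋-trans (▷▷-≋ (capNest n) ↓ z) (capNest-▷ n (↓ ∷ z))))))

  cupNest-▷ : ∀ n z → cupNest n ▷ z ≋ cups n z
  cupNest-▷ zero    z = het (⊗-idˡ _)
  cupNest-▷ (suc n) z = ≋-trans (≋-⊗ (≋-castM refl _ _) (het ≈-refl))
    (≋-trans (het (≈-trans (▷-∘ _ _ z) (∘-congʳ (▷▷ ↑ _ z))))
      (≋-∘ (≋-◁ u (≋-trans (▷▷-≋ (cupNest n) ↓ z) (cupNest-▷ n (↓ ∷ z)))) (het ≈-refl)))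

  ▷-[] : ∀ {a b} (f : Mor a b) → f ≋ f ▷ []
  ▷-[] f = ≋-trans (het (≈-sym (⊗-idʳ f))) (≋-castM _ _ _)

  Tr'-closeW : ∀ {n} (w : Word n) → Tr' (crossW w) ≈ closeW w
  Tr'-closeW {n} w = ≋⇒≈
    (≋-∘ (≋-◁ u (≋-trans (▷-[] (capNest n)) (capNest-▷ n [])))
      (≋-∘ (≋-trans (het (crossW-▷ w (downs n))) (crossIn-≋ w D≡))
           (≋-◁ u (≋-trans (▷-[] (cupNest n)) (cupNest-▷ n [])))))
    where
    D≡ : downs n ≡ downsOnto n []
    D≡ = trans (sym (++-identityʳ (downs n))) (sym (downsOnto-++ n []))

  -- Invariance under the Coxeter relations and under conjugation

  ~-crossIn : ∀ {n} {w v : Word n} → w ~ v → ∀ z → crossIn w z ≈ crossIn v z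
  ~-crossIn ~-refl        z = ≈-refl
  ~-crossIn (~-sym p)     z = ≈-sym (~-crossIn p z)
  ~-crossIn (~-trans p q) z = ≈-trans (~-crossIn p z) (~-crossIn q z)
  ~-crossIn (~-++ {w = w} {w'} {v} {v'} p q) z = begin
    crossIn (w ++ v) z           ≈⟨ crossIn-++ w v z ⟩
    crossIn w z ∘ crossIn v z    ≈⟨ ∘-cong (~-crossIn p z) (~-crossIn q z) ⟩
    crossIn w' z ∘ crossIn v' z  ≈⟨ crossIn-++ w' v' z ⟨
    crossIn (w' ++ v') z         ∎
  ~-crossIn (~-shift {w = w} {v} p) z =
    ≈-trans (crossIn-suc w z) (≈-trans (◁-cong u (~-crossIn p z)) (≈-sym (crossIn-suc v z)))
  ~-crossIn ~-square z = begin
    X ▷ e ∘ X ▷ e ∘ idm (↑ ∷ ↑ ∷ e)  ≈⟨ ∘-congˡ (∘-idʳ _) ⟩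
    X ▷ e ∘ X ▷ e                    ≈⟨ ▷-∘ X X e ⟨
    (X ∘ X) ▷ e                      ≈⟨ ▷-cong e rel1 ⟩
    idm uu ▷ e                       ≈⟨ ⊗-idm uu e ⟩
    idm (↑ ∷ ↑ ∷ e)                  ∎
    where e = ups _ ++ z
  ~-crossIn ~-braid z = ≈-trans (∘-congˡ (∘-congˡ (∘-idʳ _)))
    (≈-trans (braid _) (∘-congˡ (∘-congˡ (≈-sym (∘-idʳ _)))))
  ~-crossIn (~-far i) z = ≈-trans (∘-congˡ (∘-idʳ _))
    (≈-trans (X-slide (crossAtIn i z)) (∘-congˡ (≈-sym (∘-idʳ _))))

  ~-closeW : ∀ {n} {w v : Word n} → w ~ v → closeW w ≈ closeW v
  ~-closeW {n} p = closure-cong n (~-crossIn p _)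

  ≃-closeW : ∀ {n} {w v : Word n} → w ≃ v → closeW w ≈ closeW v
  ≃-closeW (≃-act p)      = ~-closeW (≐⇒~ _ _ p)
  ≃-closeW (≃-rotate i w) = closeW-rotate i w
  ≃-closeW (≃-trans p q)  = ≈-trans (≃-closeW p) (≃-closeW q)

  -- Finite sums and grouping by permutation

  sumOver : ∀ {A : Set} {a b} → (A → Mor a b) → List A → Mor a b
  sumOver F xs = sumM (map F xs)

  sumOver-++ : ∀ {A : Set} {a b} (F : A → Mor a b) xs ys → sumOver F (xs ++ ys) ≈ sumOver F xs +ₘ sumOver F ys
  sumOver-++ F []       ys = ≈-sym (+-idˡ _)
  sumOver-++ F (x ∷ xs) ys = ≈-trans (+-congˡ (sumOver-++ F xs ys)) (≈-sym (+-assoc _ _ _))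

  sumOver-cong : ∀ {A : Set} {a b} {F G : A → Mor a b} xs → (∀ {x} → x ∈ xs → F x ≈ G x) → sumOver F xs ≈ sumOver G xs
  sumOver-cong []       p = ≈-refl
  sumOver-cong (x ∷ xs) p = +-cong (p (here refl)) (sumOver-cong xs (λ x∈xs → p (there x∈xs)))

  sumOver-zero : ∀ {A : Set} {a b} (xs : List A) → sumOver (λ _ → zer {a} {b}) xs ≈ zer
  sumOver-zero []       = ≈-refl
  sumOver-zero (x ∷ xs) = ≈-trans (+-idˡ _) (sumOver-zero xs)

  sumOver-+ : ∀ {A : Set} {a b} (F G : A → Mor a b) xs →
    sumOver (λ x → F x +ₘ G x) xs ≈ sumOver F xs +ₘ sumOver G xs
  sumOver-+ F G []       = ≈-sym (+-idˡ _)
  sumOver-+ F G (x ∷ xs) = begin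
    (F x +ₘ G x) +ₘ sumOver (λ x → F x +ₘ G x) xs      ≈⟨ +-congˡ (sumOver-+ F G xs) ⟩
    (F x +ₘ G x) +ₘ (sumOver F xs +ₘ sumOver G xs)     ≈⟨ +-assoc _ _ _ ⟩
    F x +ₘ (G x +ₘ (sumOver F xs +ₘ sumOver G xs))     ≈⟨ +-congˡ (+-assoc _ _ _) ⟨
    F x +ₘ ((G x +ₘ sumOver F xs) +ₘ sumOver G xs)     ≈⟨ +-congˡ (+-congʳ (+-comm _ _)) ⟩
    F x +ₘ ((sumOver F xs +ₘ G x) +ₘ sumOver G xs)     ≈⟨ +-congˡ (+-assoc _ _ _) ⟩
    F x +ₘ (sumOver F xs +ₘ (G x +ₘ sumOver G xs))     ≈⟨ +-assoc _ _ _ ⟨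
    (F x +ₘ sumOver F xs) +ₘ (G x +ₘ sumOver G xs)     ∎

  ntimes-+ : ∀ {a b} m k (f : Mor a b) → ntimes (m + k) f ≈ ntimes m f +ₘ ntimes k f
  ntimes-+ zero    k f = ≈-sym (+-idˡ _)
  ntimes-+ (suc m) k f = ≈-trans (+-congˡ (ntimes-+ m k f)) (≈-sym (+-assoc _ _ _))

  sumOver-indicator : ∀ {a b} (G : Key → Mor a b) κ₀ {κs} → Unique κs → κ₀ ∈ κs →
    sumOver (λ κ → ntimes (indicator (does (κ₀ ≟ᴷ κ))) (G κ)) κs ≈ G κ₀
  sumOver-indicator G κ₀ {κ ∷ κs} (κ∉κs ∷ _) (here refl) = begin
    F κ₀ +ₘ sumOver F κs             ≈⟨ +-cong hit (sumOver-cong κs miss) ⟩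
    G κ₀ +ₘ sumOver (λ _ → zer) κs   ≈⟨ ≈-trans (+-congˡ (sumOver-zero κs)) (+-idʳ _) ⟩
    G κ₀                             ∎
    where
    F : Key → Mor _ _
    F κ = ntimes (indicator (does (κ₀ ≟ᴷ κ))) (G κ)

    hit : F κ₀ ≈ G κ₀
    hit with κ₀ ≟ᴷ κ₀
    ... | yes _ = +-idʳ _
    ... | no ¬p = contradiction refl ¬p

    miss : ∀ {κ} → κ ∈ κs → F κ ≈ zer
    miss {κ} κ∈κs with κ₀ ≟ᴷ κ
    ... | yes refl = contradiction refl (All.lookup κ∉κs κ∈κs)
    ... | no _     = ≈-refl
  sumOver-indicator G κ₀ {κ ∷ κs} (κ∉κs ∷ κs!) (there κ₀∈κs) with κ₀ ≟ᴷ κ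
  ... | yes refl = contradiction refl (All.lookup κ∉κs κ₀∈κs)
  ... | no _     = ≈-trans (+-idˡ _) (sumOver-indicator G κ₀ κs! κ₀∈κs)

  -- Double counting: every word is caught by some key because `key w ∈ κs`, and by only one because
  -- the keys are distinct.
  sumOver-multiplicity : ∀ {a b} (G : Key → Mor a b) {κs} → Unique κs → ∀ ws → (∀ {w} → w ∈ ws → key w ∈ κs) →
    sumOver (λ κ → ntimes (multiplicity ws κ) (G κ)) κs ≈ sumOver (λ w → G (key w)) ws
  sumOver-multiplicity G {κs} κs! []       ws⊆κs = sumOver-zero κs
  sumOver-multiplicity G {κs} κs! (w ∷ ws) ws⊆κs = begin
    sumOver (λ κ → ntimes (multiplicity (w ∷ ws) κ) (G κ)) κs
      ≈⟨ sumOver-cong κs (λ {κ} _ → ntimes-+ (indicator (does (key w ≟ᴷ κ))) (multiplicity ws κ) (G κ)) ⟩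
    sumOver (λ κ → ntimes (indicator (does (key w ≟ᴷ κ))) (G κ) +ₘ ntimes (multiplicity ws κ) (G κ)) κs
      ≈⟨ sumOver-+ _ _ κs ⟩
    sumOver (λ κ → ntimes (indicator (does (key w ≟ᴷ κ))) (G κ)) κs +ₘ sumOver (λ κ → ntimes (multiplicity ws κ) (G κ)) κs
      ≈⟨ +-cong (sumOver-indicator G (key w) κs! (ws⊆κs (here refl)))
                (sumOver-multiplicity G κs! ws (λ w∈ws → ws⊆κs (there w∈ws))) ⟩
    sumOver (λ w → G (key w)) (w ∷ ws) ∎

  -- The expansion of powers of the dot

  value : Term → Mor u u
  value (n , ts) = closeW (words ts)

  dot-value : ∀ t → dot ∘ value t ≈ sumOver value (step t)
  dot-value (n , ts) = begin
    dot ∘ closeW (words ts)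
      ≈⟨ dot-closeW (words ts) ⟩
    closeW (star (fromℕ n) ++ map inject₁ (words ts)) +ₘ sumM (tabulate {n = n} (λ j → closeW (star j ++ words ts)))
      ≡⟨ cong₂ (λ w fs → closeW (star (fromℕ n) ++ w) +ₘ sumM fs) (words-widen ts)
           (map-tabulate {n = n} (λ j → n , swap0 j ∷ ts) value) ⟨
    sumOver value (step (n , ts)) ∎

  dot-terms : ∀ ts → dot ∘ sumOver value ts ≈ sumOver value (concatMap step ts)
  dot-terms []       = ∘-zerʳ dot
  dot-terms (t ∷ ts) = begin
    dot ∘ (value t +ₘ sumOver value ts)                       ≈⟨ ∘-distˡ _ _ _ ⟩
    dot ∘ value t +ₘ dot ∘ sumOver value ts                   ≈⟨ +-cong (dot-value t) (dot-terms ts) ⟩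
    sumOver value (step t) +ₘ sumOver value (concatMap step ts) ≈⟨ sumOver-++ value (step t) (concatMap step ts) ⟨
    sumOver value (concatMap step (t ∷ ts))                   ∎

  dotPow-terms : ∀ k → dotPow k ≈ sumOver value (terms k)
  dotPow-terms zero    = ≈-sym (begin
    (u ◁ idm [] ∘ idm u ∘ u ◁ idm []) +ₘ zer  ≈⟨ +-idʳ _ ⟩
    u ◁ idm [] ∘ idm u ∘ u ◁ idm []           ≈⟨ ∘-cong (⊗-idm u []) (≈-trans (∘-idˡ _) (⊗-idm u [])) ⟩
    idm u ∘ idm u                             ≈⟨ ∘-idˡ _ ⟩
    idm u                                     ∎)
  dotPow-terms (suc k) = ≈-trans (∘-congˡ (dotPow-terms k)) (dot-terms (terms k))

  dotPow-shortWords : ∀ k → dotPow k ≈ sumOver (λ (n , w) → closeW w) (shortWords k)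
  dotPow-shortWords k = begin
    dotPow k
      ≈⟨ dotPow-terms k ⟩
    sumOver value (terms k)
      ≈⟨ sumOver-cong (terms k) (λ { {n , ts} _ → ≃-closeW (proj₁ (proj₂ (shorten ts))) }) ⟩
    sumOver (λ t → closeW (proj₂ (shortWord t))) (terms k)
      ≡⟨ cong sumM (map-∘ (terms k)) ⟩
    sumOver (λ (n , w) → closeW w) (shortWords k) ∎

theorem5p1 : ∀ {c ℓ} (R : CommutativeRing c ℓ) (k : ℕ) →
    let open Heis R in
    Σ ((n' : ℕ) → Perm (suc n') → ℕ) λ m →
    ((n' : ℕ) (σ : Perm (suc n')) → ¬ (m n' σ ≡ 0) →
    (L : ℕ) → IsLength σ L → (L ≤ k) × (L % 2 ≡ k % 2))
    × ((rw : (n' : ℕ) → Perm (suc n') → Word n') →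
    ((n' : ℕ) (σ : Perm (suc n')) → IsPerm σ → prodW (rw n' σ) ≡ σ) →
    dotPow k ≈ sumM (concatMap (λ n' → map (λ σ → ntimes (m n' σ) (Tr' (crossW (rw n' σ)))) (allPerms (suc n'))) (upTo (suc k))))
-- The multiplicities come from `shortWords k` alone, so they depend neither on the ground ring nor
-- on the words `rw` chosen for the permutations.
theorem5p1 R k = (λ n σ → multiplicity ws (n , σ)) , support , expansion
  where
  open Heis R
  open Diagrams R

  ws : List IndexedWord
  ws = shortWords k

  support : ∀ n (σ : Perm (suc n)) → multiplicity ws (n , σ) ≢ 0 → ∀ L → IsLength σ L → L ≤ k × L % 2 ≡ k % 2
  support n σ m≢0 L ((v , v≡σ , refl) , minimal) with multiplicity-∈ ws (n , σ) m≢0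
  ... | (n , w) , w∈ws , refl with All.lookup (shortWords-bounded k) w∈ws
  -- The word `w` bounds L because `v` is a shortest word with the same product; equality of
  -- products is then turned into Coxeter moves from `v` to `w`, and these preserve parity.
  ...   | _ , l = ≤-trans (minimal w refl) (≼⇒≤ l) , trans (~-parity (prodW⇒~ v w v≡σ)) (≼⇒parity l)

  module _ (rw : (n : ℕ) → Perm (suc n) → Word n)
           (rw-prodW : (n : ℕ) (σ : Perm (suc n)) → IsPerm σ → prodW (rw n σ) ≡ σ) where

    G : Key → Mor u u
    G (n , σ) = Tr' (crossW (rw n σ))

    expansion : dotPow k ≈ sumM (concatMap (λ n → map (λ σ → ntimes (multiplicity ws (n , σ)) (G (n , σ))) (allPerms (suc n))) (upTo (suc k)))
    expansion = begin
      dotPow k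
        ≈⟨ dotPow-shortWords k ⟩
      sumOver (λ (n , w) → closeW w) ws
        ≈⟨ sumOver-cong ws (λ { {n , w} _ → ≈-trans (~-closeW (prodW⇒~ w (rw n (prodW w)) (sym (rw-prodW n (prodW w) (prodW-isPerm w))))) (≈-sym (Tr'-closeW _)) }) ⟩
      sumOver (λ w → G (key w)) ws
        ≈⟨ sumOver-multiplicity G (keys-unique k) ws
             (λ { {n , w} w∈ws → ∈-keys (prodW w) (proj₁ (All.lookup (shortWords-bounded k) w∈ws)) (prodW-isPerm w) }) ⟨
      sumOver (λ κ → ntimes (multiplicity ws κ) (G κ)) (keys k)
        ≡⟨ cong sumM (map-keys (λ κ → ntimes (multiplicity ws κ) (G κ)) (upTo (suc k))) ⟩
      sumM (concatMap (λ n → map (λ σ → ntimes (multiplicity ws (n , σ)) (G (n , σ))) (allPerms (suc n))) (upTo (suc k))) ∎
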